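{- For every odd integer $n \ge 7$, the domination number of the Johnson graph $J(n,3)$ satisfies $$\gamma(J(n,3)) \;=\; \phi_n .$$
   Context: All graphs are finite, undirected, simple and loopless. The Johnson graph $J(n,k)$ has vertex set $\binom{[n]}{k}$ (the $k$-element subsets of $[n]=\{1,\dots,n\}$), two vertices being adjacent if and only if their intersection has size exactly $k-1$. A dominating set of a graph $G$ is a set $D \subseteq V(G)$ such that every vertex of $G$ lies in $D$ or has a neighbour in $D$; the domination number $\gamma(G)$ is the minimum size of a dominating set. For a graph $G$, an edge-covering by triangles is a set $T$ of triangles of $G$ such that every edge of $G$ lies in some triangle of $T$; $\rho_\Delta(G)$ denotes the minimum size of such a $T$ (and $\rho_\Delta(G)=\infty$ if none exists). For $m\ge 3$ put $|C_m| := \rho_\Delta(K_m)$. By a theorem of Fort and Hedlund, $|C_m| = m^2/6$ if $m\equiv 0 \pmod 6$; $m(m-1)/6$ if $m\equiv 1,3 \pmod 6$; $(m^2+2)/6$ if $m\equiv 2,4\pmod 6$; $(m^2-m+4)/6$ if $m\equiv 5\pmod 6$. For $n \ge 6$ define $$\phi_n := \min\{ |C_{m_1}| + |C_{m_2}| : m_1+m_2=n,\ m_1,m_2\ge 3\}.$$ For odd $n\ge 7$ this has the closed form $\phi_n = (n^2-n+b_n)/12$, where $b_n = 0$ if $n\equiv 1$, $b_n=4$ if $n\equiv 5$, $b_n=6$ if $n\equiv 3,7$, $b_n=10$ if $n\equiv 11$, and $b_n=12$ if $n\equiv 9 \pmod{12}$. -}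

module Defs where

open import Data.Fin.Base using (Fin)
open import Data.Fin.Subset using (Subset; inside; outside; ∣_∣; _∩_)
open import Data.Fin.Subset.Properties using (∩-comm; ∩-idem)
open import Data.List.Base using (List; []; _∷_; [_]; _++_; map; length; allFin)
open import Data.List.Membership.Propositional using (_∈_)
open import Data.List.Membership.Propositional.Properties
  using (∈-map⁺; ∈-++⁺ˡ; ∈-++⁺ʳ; ∈-allFin)
open import Data.List.Relation.Unary.AllPairs using (AllPairs)
open import Data.List.Relation.Unary.Any using (Any; here)
open import Data.List.Relation.Unary.Unique.Propositional using (Unique)
open import Data.Nat.Base using (ℕ; zero; suc; _+_; _≤_)
open import Data.Nat.Properties using (≤-antisym; 1+n≢n)
open import Data.Product.Base using (Σ; _×_; _,_; ∃-syntax)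
open import Data.Sum.Base using (_⊎_)
open import Data.Vec.Base using ([]; _∷_)
open import Function.Bundles using (_⇔_)
open import Relation.Binary.PropositionalEquality
  using (_≡_; _≢_; refl; sym; trans; cong)
open import Relation.Nullary.Negation using (¬_)

IsMinimum : (ℕ → Set) → ℕ → Set
IsMinimum P m = P m × (∀ k → P k → m ≤ k)

-- A quantity defined as a minimum is rendered as the relation "m is the
-- minimum"; by this lemma the relation has at most one value.
minimum-unique : ∀ {P : ℕ → Set} {m k} → IsMinimum P m → IsMinimum P k → m ≡ k
minimum-unique (pm , m≤) (pk , k≤) = ≤-antisym (m≤ _ pk) (k≤ _ pm)

record Graph : Set₁ where
  field
    Vertex    : Set
    Adj       : Vertex → Vertex → Set
    symmetric : ∀ {u v} → Adj u v → Adj v u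
    loopless  : ∀ {v} → ¬ Adj v v
    finite    : ∃[ vs ] (∀ (v : Vertex) → v ∈ vs)

-- Finite sets of vertices are duplicate-free lists, so that length is
-- cardinality.
module _ (G : Graph) where
  open Graph G

  IsDominating : List Vertex → Set
  IsDominating D = ∀ v → v ∈ D ⊎ (∃[ u ] (u ∈ D × Adj v u))

  IsDominationNumber : ℕ → Set
  IsDominationNumber =
    IsMinimum (λ k → ∃[ D ] (Unique D × IsDominating D × length D ≡ k))

  record Triangle : Set where
    field
      a b c : Vertex
      a~b   : Adj a b
      b~c   : Adj b c
      a~c   : Adj a c

module _ {G : Graph} where
  open Graph G

  _∈△_ : Vertex → Triangle G → Set
  v ∈△ t = v ≡ a ⊎ v ≡ b ⊎ v ≡ c
    where open Triangle t

  -- Triangles are unordered: two of them are the same when they have the same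
  -- vertex set.
  _≈△_ : Triangle G → Triangle G → Set
  s ≈△ t = ∀ v → (v ∈△ s) ⇔ (v ∈△ t)

  IsTriangleSet : List (Triangle G) → Set
  IsTriangleSet = AllPairs (λ s t → ¬ (s ≈△ t))

  CoversEdges : List (Triangle G) → Set
  CoversEdges T = ∀ u v → Adj u v → Any (λ t → u ∈△ t × v ∈△ t) T

-- The relation "ρ_Δ(G) = k".  The convention ρ_Δ(G) = ∞ corresponds to no k
-- satisfying it.
IsTriangleCoveringNumber : Graph → ℕ → Set
IsTriangleCoveringNumber G =
  IsMinimum (λ k → ∃[ T ] (IsTriangleSet {G} T × CoversEdges {G} T × length T ≡ k))

K : ℕ → Graph
K m = record
  { Vertex    = Fin m
  ; Adj       = _≢_
  ; symmetric = λ u≢v v≡u → u≢v (sym v≡u)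
  ; loopless  = λ v≢v → v≢v refl
  ; finite    = allFin m , ∈-allFin
  }

-- The relation "φ_n = s", where |C_m| = ρ_Δ(K_m).
IsPhi : ℕ → ℕ → Set
IsPhi n = IsMinimum λ s →
  ∃[ m₁ ] ∃[ m₂ ] ∃[ c₁ ] ∃[ c₂ ]
    ( m₁ + m₂ ≡ n × 3 ≤ m₁ × 3 ≤ m₂
    × IsTriangleCoveringNumber (K m₁) c₁
    × IsTriangleCoveringNumber (K m₂) c₂
    × c₁ + c₂ ≡ s )

KSubset : ℕ → ℕ → Set
KSubset n k = Σ (Subset n) (λ p → ∣ p ∣ ≡ k)

addOutside : ∀ {n k} → KSubset n k → KSubset (suc n) k
addOutside (p , e) = outside ∷ p , e

addInside : ∀ {n k} → KSubset n k → KSubset (suc n) (suc k)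
addInside (p , e) = inside ∷ p , cong suc e

kSubsets : ∀ n k → List (KSubset n k)
kSubsets zero    zero    = [ [] , refl ]
kSubsets zero    (suc k) = []
kSubsets (suc n) zero    = map addOutside (kSubsets n zero)
kSubsets (suc n) (suc k) = map addOutside (kSubsets n (suc k)) ++ map addInside (kSubsets n k)

∈-kSubsets : ∀ n k (s : KSubset n k) → s ∈ kSubsets n k
∈-kSubsets zero    zero    ([] , refl) = here refl
∈-kSubsets (suc n) zero    (outside ∷ p , e) = ∈-map⁺ addOutside (∈-kSubsets n zero (p , e))
∈-kSubsets (suc n) (suc k) (outside ∷ p , e) =
  ∈-++⁺ˡ (∈-map⁺ addOutside (∈-kSubsets n (suc k) (p , e)))
∈-kSubsets (suc n) (suc k) (inside ∷ p , refl) =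
  ∈-++⁺ʳ (map addOutside (kSubsets n (suc k))) (∈-map⁺ addInside (∈-kSubsets n k (p , refl)))

Johnson : ℕ → ℕ → Graph
Johnson n k = record
  { Vertex    = KSubset n k
  -- |p ∩ q| = k - 1, without truncated subtraction
  ; Adj       = λ (p , _) (q , _) → suc ∣ p ∩ q ∣ ≡ k
  ; symmetric = λ {(p , _)} {(q , _)} e → trans (cong (λ r → suc ∣ r ∣) (∩-comm q p)) e
  ; loopless  = λ {(p , ∣p∣≡k)} e →
      1+n≢n (trans (cong (λ r → suc ∣ r ∣) (sym (∩-idem p))) (trans e (sym ∣p∣≡k)))
  ; finite    = kSubsets n k , ∈-kSubsets n k
  }

{-# OPTIONS --safe #-}
module Submission where

-- Let n = 2k + 1.  A family D of triples dominates J(n,3) exactly when the pairs lying in no triple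
-- of D form a triangle-free graph H.  Let r v be the number of triples through v and s v = k - r v.
-- The H-degree of v is at least 2 (s v), so for an edge uv of H the disjointness of the
-- neighbourhoods gives 2 (s u + s v) ≤ n, and by parity s u + s v ≤ k.  Looking at a vertex that
-- maximises s one gets 2 ∑ s ≤ n k, that is, 6 |D| ≥ n k.  Equality forces 2 (r v) = k for all v; then
-- some k + 1 points have all their pairs covered and are closed under the triples of D, so counting
-- incidences shows 6 ∣ k (k + 1), which fails for k ≡ 4 (mod 6).
--
-- Coverings of K_k and K_{k+1} of the sizes of Fort and Hedlund (from the triple systems of Bose and
-- Skolem and the pairwise balanced designs with one block of size 5) attain this bound up to
-- rounding.  As triangle coverings of K_{m₁} and K_{m₂} with m₁ + m₂ = n form a dominating family,
-- the same bound also shows that these coverings and the splitting n = k + (k + 1) are optimal.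

open import Defs
open import Algebra.Properties.Semiring.Sum using ()
open import Data.Bool.Base using (Bool; true; false; _∧_; _∨_; not; if_then_else_)
open import Data.Bool.Properties using (¬-not) renaming (_≟_ to _≟ᵇ_)
open import Data.Empty using (⊥; ⊥-elim)
open import Data.Fin.Base using (Fin; zero; suc; toℕ; cast; combine; remQuot; splitAt; _↑ˡ_; _↑ʳ_; inject₁; punchIn; punchOut)
open import Data.Fin.Patterns using (0F; 1F; 2F; 3F; 4F; 5F)
import Data.Fin.Properties as Fin
open import Data.Fin.Subset using (Subset; ∣_∣; _∩_) renaming (⊥ to ∅)
open import Data.Fin.Subset.Properties using (∣⊥∣≡0; ∩-zeroˡ; ∣p∩q∣≤∣p∣; ∣p∩q∣≤∣q∣)
open import Data.List.Base as List using (List; []; _∷_; _++_; length; deduplicate; tabulate)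
open import Data.List.Membership.Propositional using (_∈_; find)
open import Data.List.Membership.Propositional.Properties using (∈-deduplicate⁺; ∈-++⁺ˡ; ∈-++⁺ʳ; ∈-map⁺)
open import Data.List.Properties using (length-deduplicate; length-++; length-map; length-tabulate)
open import Data.List.Relation.Unary.All.Properties using (all-filter)
open import Data.List.Relation.Unary.AllPairs using (AllPairs; []; _∷_)
import Data.List.Relation.Unary.AllPairs.Properties as AllPairs
open import Data.List.Relation.Unary.Any using (here; there)
import Data.List.Relation.Unary.Any.Properties as Any
open import Data.List.Relation.Unary.Unique.Propositional using (Unique)
open import Data.Nat.Base
open import Data.Nat.DivMod using (_%_; _/_; _mod_; _divMod_; result; m≡m%n+[m/n]*n; [m+kn]%n≡m%n; m<n⇒m%n≡m; m%n<n)
open import Data.Nat.Divisibility using (_∣_; _∤_; divides; ∣m+n∣m⇒∣n; m∣m*n; _∣0; ∣m∣n⇒∣m+n; *-monoʳ-∣; >⇒∤)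
open import Data.Nat.ListAction using () renaming (sum to sumˡ)
open import Data.Nat.Properties
open import Data.Nat.Tactic.RingSolver using (solve-∀)
open import Data.Product.Base using (Σ; _×_; _,_; ∃-syntax; proj₁; proj₂; map)
open import Data.Product.Function.NonDependent.Propositional using (_×-↔_)
import Data.Product.Properties as Product
open import Data.Sum.Base as Sum using (_⊎_; inj₁; inj₂; [_,_])
open import Data.Sum.Function.Propositional using (_⊎-↔_)
open import Data.Vec.Base using ([]; _∷_; lookup; _[_]≔_)
import Data.Vec.Properties as Vec
open import Function.Base using (_∘_; id)
open import Function.Bundles using (_↔_; mk⇔; Inverse; Equivalence)
open import Function.Construct.Composition using (_↔-∘_)
open import Function.Construct.Identity using (↔-id)
open import Function.Construct.Symmetry using (↔-sym)
open import Function.Properties.Inverse using (↔⇒↣)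
open import Relation.Binary.Definitions using (Decidable; DecidableEquality)
open import Relation.Binary.PropositionalEquality hiding (J; [_])
open import Relation.Nullary using (¬_; Dec; yes; no; does; contradiction)
open import Relation.Nullary.Decidable using (map′; from-yes; _→-dec_; _×-dec_; _⊎-dec_; ¬?)

open Algebra.Properties.Semiring.Sum +-*-semiring
  using (sum; sum-syntax; ∑-distrib-+; sum-cong-≗; *-distribˡ-sum; *-distribʳ-sum)

-- The extremal picture is the complete bipartite graph with sides of k and k + 1 points as H, where
-- the two sides carry exact coverings. Such coverings exist only for some k: with the best
-- available ones, 6 times the number of triples exceeds nk by 3, 6, 5, 0, 3, 2 for k ≡ 3, 4, 5, 0,
-- 1, 2 (mod 6). An excess below 6 is harmless because |D| is an integer. Only the excess 6, at k ≡
-- 4, requires excluding equality.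
--
-- The k + 1 points in the equality case come from the degrees of H, which are then all at least k.
-- If some degree exceeds k, the neighbourhood of that vertex serves, since it spans no edge of H.
-- If H is k-regular, a neighbourhood is one point short and has to be enlarged. This fails for the
-- 5-cycle, where k = 2, and it is here that k ≥ 3 enters.

private variable
  n k m : ℕ
  A A′ I J : Set

-- Finite sums and indicator values

∑-mono-≤ : {f g : Fin n → ℕ} → (∀ i → f i ≤ g i) → sum f ≤ sum g
∑-mono-≤ {zero}  f≤g = z≤n
∑-mono-≤ {suc n} f≤g = +-mono-≤ (f≤g zero) (∑-mono-≤ (f≤g ∘ suc))

+-mono-≤-cancel : ∀ {a b c d} → a ≤ b → c ≤ d → b + d ≤ a + c → a ≡ b × c ≡ d
+-mono-≤-cancel {a} {b} {c} {d} a≤b c≤d le =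
  ≤-antisym a≤b (+-cancelʳ-≤ d b a (≤-trans le (+-monoʳ-≤ a c≤d))) ,
  ≤-antisym c≤d (+-cancelˡ-≤ b d c (≤-trans le (+-monoˡ-≤ c a≤b)))

∑-mono-≤-cancel : {f g : Fin n → ℕ} → (∀ i → f i ≤ g i) → sum g ≤ sum f → ∀ i → f i ≡ g i
∑-mono-≤-cancel {suc n} f≤g le zero =
  proj₁ (+-mono-≤-cancel (f≤g zero) (∑-mono-≤ (f≤g ∘ suc)) le)
∑-mono-≤-cancel {suc n} f≤g le (suc i) = ∑-mono-≤-cancel (f≤g ∘ suc)
  (≤-reflexive (sym (proj₂ (+-mono-≤-cancel (f≤g zero) (∑-mono-≤ (f≤g ∘ suc)) le)))) i

∑-const : ∀ n c → ∑[ _ < n ] c ≡ n * c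
∑-const zero    c = refl
∑-const (suc n) c = cong (c +_) (∑-const n c)

∑-positive : (f : Fin n → ℕ) → 0 < sum f → ∃[ i ] 0 < f i
∑-positive {suc n} f 0<∑ with f zero in eq
... | suc _ = zero , subst (0 <_) (sym eq) z<s
... | zero with ∑-positive (f ∘ suc) 0<∑
...   | i , 0<fi = suc i , 0<fi

argmax : (f : Fin (suc n) → ℕ) → ∃[ w ] (∀ v → f v ≤ f w)
argmax {zero}  f = zero , λ { zero → ≤-refl }
argmax {suc n} f with argmax (f ∘ suc)
... | w , max with ≤-total (f zero) (f (suc w))
...   | inj₁ le = suc w , λ { zero → le ; (suc v) → max v }
...   | inj₂ ge = zero , λ { zero → ≤-refl ; (suc v) → ≤-trans (max v) ge }

χ : Bool → ℕ
χ b = if b then 1 else 0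

χ≤1 : ∀ b → χ b ≤ 1
χ≤1 true  = ≤-refl
χ≤1 false = z≤n

χ-positive : ∀ b → 0 < χ b → b ≡ true
χ-positive true _ = refl

δ : Fin n → Fin n → Bool
δ u v = does (u Fin.≟ v)

δ-≡ : ∀ {u v : Fin n} → δ u v ≡ true → u ≡ v
δ-≡ {u = u} {v} eq with u Fin.≟ v
... | yes u≡v = u≡v

δ-refl : ∀ (v : Fin n) → δ v v ≡ true
δ-refl v with v Fin.≟ v
... | yes _  = refl
... | no v≢v = contradiction refl v≢v

∑-δ : ∀ (v : Fin n) → ∑[ u < n ] χ (δ u v) ≡ 1
∑-δ {suc n} zero = cong suc (trans (∑-const n 0) (*-zeroʳ n))
∑-δ {suc n} (suc v) = trans (sum-cong-≗ λ u → cong χ (δ-suc u)) (∑-δ v)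
  where
  δ-suc : ∀ u → δ (suc u) (suc v) ≡ δ u v
  δ-suc u with u Fin.≟ v
  ... | yes _ = refl
  ... | no _  = refl

χ-disjoint : ∀ {a b} → (a ≡ true → b ≡ true → ⊥) → χ a + χ b ≤ 1
χ-disjoint {true}  {true}  ab = ⊥-elim (ab refl refl)
χ-disjoint {true}  {false} ab = ≤-refl
χ-disjoint {false} {b}     ab = χ≤1 b

χ-disjoint₃ : ∀ {a b c} → (a ≡ true → b ≡ true → ⊥) → (a ≡ true → c ≡ true → ⊥) →
              (b ≡ true → c ≡ true → ⊥) → χ a + χ b + χ c ≤ 1
χ-disjoint₃ {true}  {true}          ab ac bc = ⊥-elim (ab refl refl)
χ-disjoint₃ {true}  {false} {true}  ab ac bc = ⊥-elim (ac refl refl)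
χ-disjoint₃ {true}  {false} {false} ab ac bc = ≤-refl
χ-disjoint₃ {false}                 ab ac bc = χ-disjoint bc

∑-+-bound : (f g : Fin n → ℕ) (c : ℕ) → (∀ i → f i + g i ≤ c) → sum f + sum g ≤ n * c
∑-+-bound {n} f g c le = begin
  sum f + sum g            ≡⟨ ∑-distrib-+ f g ⟨
  ∑[ i < n ] (f i + g i)   ≤⟨ ∑-mono-≤ le ⟩
  ∑[ _ < n ] c             ≡⟨ ∑-const n c ⟩
  n * c                    ∎
  where open ≤-Reasoning

∑-+-+-bound : (f g h : Fin n → ℕ) (c : ℕ) → (∀ i → f i + g i + h i ≤ c) → sum f + sum g + sum h ≤ n * c
∑-+-+-bound {n} f g h c le = begin
  sum f + sum g + sum h          ≡⟨ cong (_+ sum h) (∑-distrib-+ f g) ⟨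
  sum (λ i → f i + g i) + sum h  ≤⟨ ∑-+-bound (λ i → f i + g i) h c le ⟩
  n * c                          ∎
  where open ≤-Reasoning

halve : ∀ a b → 2 * a ≤ suc (2 * b) → a ≤ b
halve a b le with a ≤? b
... | yes a≤b = a≤b
... | no a≰b  = contradiction
  (≤-trans (≤-reflexive (sym (*-suc 2 b))) (≤-trans (*-monoʳ-≤ 2 (≰⇒> a≰b)) le)) 1+n≰n

-- Triangle-free graphs on 2k + 1 vertices

module TriangleFree
  (k : ℕ)
  (H : Fin (suc (2 * k)) → Fin (suc (2 * k)) → Bool)
  (H-sym : ∀ {u v} → H u v ≡ true → H v u ≡ true)
  (H-irrefl : ∀ {v} → H v v ≡ true → ⊥)
  (H-free : ∀ {u v w} → H u v ≡ true → H v w ≡ true → H u w ≡ true → ⊥)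
  where

  private
    N : ℕ
    N = suc (2 * k)

  h : Fin N → ℕ
  h v = ∑[ u < N ] χ (H v u)

  neighbourhoods-disjoint : ∀ {u v} → H u v ≡ true → h u + h v ≤ N
  neighbourhoods-disjoint {u} {v} uv = subst (h u + h v ≤_) (*-identityʳ N)
    (∑-+-bound (λ x → χ (H u x)) (λ x → χ (H v x)) 1 λ x → χ-disjoint λ ux vx → H-free uv vx ux)

  module Mantel (r : Fin (suc (2 * k)) → ℕ) (degree : ∀ v → suc (2 * k) ≤ suc (h v + 2 * r v)) where

    -- Truncated at 0 where r v > k, so r v + s v may exceed k. The inequality `k≤r+s` is in the
    -- direction that the lower bound on the sum of r needs.
    s : Fin N → ℕ
    s v = k ∸ r v

    k≤r+s : ∀ v → k ≤ r v + s v
    k≤r+s v = m≤n+m∸n k (r v)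

    2s≤h : ∀ v → 2 * s v ≤ h v
    2s≤h v = begin
      2 * (k ∸ r v)      ≡⟨ *-distribˡ-∸ 2 k (r v) ⟩
      2 * k ∸ 2 * r v    ≤⟨ m≤n+o⇒m∸n≤o (2 * k) (2 * r v) (≤-trans (s≤s⁻¹ (degree v))
                             (≤-reflexive (+-comm (h v) (2 * r v)))) ⟩
      h v                ∎
      where open ≤-Reasoning

    edge : ∀ {u v} → H u v ≡ true → s u + s v ≤ k
    edge {u} {v} uv = halve (s u + s v) k (begin
      2 * (s u + s v)      ≡⟨ *-distribˡ-+ 2 (s u) (s v) ⟩
      2 * s u + 2 * s v    ≤⟨ +-mono-≤ (2s≤h u) (2s≤h v) ⟩
      h u + h v            ≤⟨ neighbourhoods-disjoint uv ⟩
      N                    ∎)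
      where open ≤-Reasoning

    -- If the maximum M of s is at most k / 2, the bound holds termwise and equality forces every
    -- term. Otherwise the many neighbours of a maximising vertex have small weight and the bound is
    -- strict, so the equality clause is vacuous. Both parts come from this one case split.
    2∑s≤nk : 2 * sum s ≤ N * k × (N * k ≤ 2 * sum s → ∀ v → 2 * s v ≡ k)
    2∑s≤nk with argmax s
    ... | w , max with 2 * s w ≤? k
    ...   | yes 2M≤k = bound , λ ge → ∑-mono-≤-cancel 2s≤k
      (≤-trans (≤-reflexive (∑-const N k)) (≤-trans ge (≤-reflexive (*-distribˡ-sum 2 s))))
      where
      2s≤k : ∀ v → 2 * s v ≤ k
      2s≤k v = ≤-trans (*-monoʳ-≤ 2 (max v)) 2M≤k
      bound : 2 * sum s ≤ N * k
      bound = begin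
        2 * sum s             ≡⟨ *-distribˡ-sum 2 s ⟩
        ∑[ v < N ] (2 * s v)  ≤⟨ ∑-mono-≤ 2s≤k ⟩
        ∑[ v < N ] k          ≡⟨ ∑-const N k ⟩
        N * k                 ∎
        where open ≤-Reasoning
    ...   | no 2M≰k = <⇒≤ below , λ ge → contradiction (≤-trans below ge) 1+n≰n
      where
      open ≤-Reasoning
      M = s w
      -- By `edge`, a neighbour of w has weight at most k - M = M - e. So each neighbour lowers the
      -- trivial estimate N * M by e, and w has at least 2M = k + e neighbours.
      e = 2 * M ∸ k
      k+e≡2M : k + e ≡ 2 * M
      k+e≡2M = m+[n∸m]≡n (<⇒≤ (≰⇒> 2M≰k))
      1≤e : 1 ≤ e
      1≤e = m<n⇒0<n∸m (≰⇒> 2M≰k)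
      pointwise : ∀ v → s v + χ (H w v) * e ≤ M
      pointwise v with H w v in eq
      ... | false = ≤-trans (≤-reflexive (+-identityʳ (s v))) (max v)
      ... | true = +-cancelˡ-≤ (M + k) _ _ (begin
        M + k + (s v + (e + 0))  ≡⟨ lem M k (s v) e ⟩
        (M + s v) + (k + e)      ≤⟨ +-mono-≤ (edge eq) (≤-reflexive k+e≡2M) ⟩
        k + 2 * M                ≡⟨ lem′ M k ⟩
        M + k + M                ∎)
        where
        lem : ∀ M k s e → M + k + (s + (e + 0)) ≡ (M + s) + (k + e)
        lem = solve-∀
        lem′ : ∀ M k → k + 2 * M ≡ M + k + M
        lem′ = solve-∀
      total : sum s + h w * e ≤ N * M
      total = ≤-trans (≤-reflexive (cong (sum s +_) (*-distribʳ-sum e (λ u → χ (H w u)))))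
        (∑-+-bound s (λ u → χ (H w u) * e) M pointwise)
      -- The estimate reads 2∑s ≤ N(k + e) - 2(k + e)e = Nk + e - 2e², and 1 + e ≤ 2e² because e ≥
      -- 1. All subtracted terms are moved to the other side.
      below : suc (2 * sum s) ≤ N * k
      below = +-cancelʳ-≤ (e + 2 * k * e) _ _ (begin
        suc (2 * sum s) + (e + 2 * k * e)    ≤⟨ ≤-reflexive (lem₁ (sum s) e k) ⟩
        2 * sum s + (2 * k * e) + (1 + e)    ≤⟨ +-monoʳ-≤ (2 * sum s + 2 * k * e)
                                                    (+-mono-≤ (*-mono-≤ 1≤e 1≤e) (m≤m*n e e {{>-nonZero 1≤e}})) ⟩
        2 * sum s + (2 * k * e) + (e * e + e * e)   ≡⟨ lem₂ (sum s) k e ⟩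
        2 * (sum s + (k + e) * e)   ≤⟨ *-monoʳ-≤ 2 (+-monoʳ-≤ (sum s) (*-monoˡ-≤ e (≤-trans (≤-reflexive k+e≡2M) (2s≤h w)))) ⟩
        2 * (sum s + h w * e)       ≤⟨ *-monoʳ-≤ 2 total ⟩
        2 * (N * M)                 ≡⟨ lem₃ N M ⟩
        N * (2 * M)                 ≡⟨ cong (N *_) k+e≡2M ⟨
        N * (k + e)                 ≡⟨ lem₄ k e ⟩
        N * k + (e + 2 * k * e)     ∎)
        where
        lem₁ : ∀ s e k → suc (2 * s) + (e + 2 * k * e) ≡ 2 * s + (2 * k * e) + (1 + e)
        lem₁ = solve-∀
        lem₂ : ∀ s k e → 2 * s + (2 * k * e) + (e * e + e * e) ≡ 2 * (s + (k + e) * e)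
        lem₂ = solve-∀
        lem₃ : ∀ N M → 2 * (N * M) ≡ N * (2 * M)
        lem₃ = solve-∀
        lem₄ : ∀ k e → suc (2 * k) * (k + e) ≡ suc (2 * k) * k + (e + 2 * k * e)
        lem₄ = solve-∀

    nk≤∑r+∑s : N * k ≤ sum r + sum s
    nk≤∑r+∑s = begin
      N * k                     ≡⟨ ∑-const N k ⟨
      ∑[ v < N ] k              ≤⟨ ∑-mono-≤ k≤r+s ⟩
      ∑[ v < N ] (r v + s v)    ≡⟨ ∑-distrib-+ r s ⟩
      sum r + sum s             ∎
      where open ≤-Reasoning

    nk+nk≤ : N * k + N * k ≤ 2 * sum r + 2 * sum s
    nk+nk≤ = begin
      N * k + N * k             ≡⟨ cong (N * k +_) (+-identityʳ (N * k)) ⟨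
      2 * (N * k)               ≤⟨ *-monoʳ-≤ 2 nk≤∑r+∑s ⟩
      2 * (sum r + sum s)       ≡⟨ *-distribˡ-+ 2 (sum r) (sum s) ⟩
      2 * sum r + 2 * sum s     ∎
      where open ≤-Reasoning

    nk≤2∑r : N * k ≤ 2 * sum r
    nk≤2∑r = +-cancelʳ-≤ (N * k) _ _ (≤-trans nk+nk≤ (+-monoʳ-≤ (2 * sum r) (proj₁ 2∑s≤nk)))

    equality : 0 < k → 2 * sum r ≤ N * k → ∀ v → 2 * r v ≡ k
    equality 0<k le v = +-cancelʳ-≡ k _ _ (begin
      2 * r v + k          ≡⟨ cong (2 * r v +_) 2s≡k ⟨
      2 * r v + 2 * s v    ≡⟨ *-distribˡ-+ 2 (r v) (s v) ⟨
      2 * (r v + s v)      ≡⟨ cong (2 *_) (m+[n∸m]≡n {r v} {k} (<⇒≤ (m∸n≢0⇒n<m s≢0))) ⟩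
      2 * k                ≡⟨ cong (k +_) (+-identityʳ k) ⟩
      k + k                ∎)
      where
      open ≡-Reasoning
      2s≡k : 2 * s v ≡ k
      2s≡k = proj₂ 2∑s≤nk (+-cancelˡ-≤ (N * k) _ _ (≤-trans nk+nk≤ (+-monoˡ-≤ (2 * sum s) le))) v
      -- A nonzero value shows that the subtraction in `s` was not truncated, so r v + s v is
      -- exactly k.
      s≢0 : s v ≢ 0
      s≢0 s≡0 = <⇒≢ 0<k (trans (cong (2 *_) (sym s≡0)) 2s≡k)

  -- An independent set of H; the name refers to the complement, the graph of covered pairs.
  Clique : (Fin N → Bool) → Set
  Clique B = ∀ {x y} → B x ≡ true → B y ≡ true → H x y ≡ true → ⊥

  LargeClique : Set
  LargeClique = ∃[ B ] (suc k ≤ ∑[ x < N ] χ (B x) × Clique B)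

  neighbourhood-clique : ∀ v → Clique (H v)
  neighbourhood-clique v vx vy xy = H-free vx xy vy

  -- The neighbourhood of v is independent because H has no triangle, and w has no neighbour in it,
  -- so w can be added as one more point.
  extend-clique : ∀ v w → k ≤ h v → ¬ H v w ≡ true →
                  (∀ x → H w x ≡ true → H v x ≡ true → ⊥) → LargeClique
  extend-clique v w k≤h v≁w sep = B , size , clique
    where
    B : Fin N → Bool
    B x = H v x ∨ δ x w
    pointwise : ∀ x → χ (δ x w) + χ (H v x) ≤ χ (B x)
    pointwise x with H v x in vx | δ x w in xw
    ... | true  | true  = contradiction (subst (λ y → H v y ≡ true) (δ-≡ xw) vx) v≁w
    ... | true  | false = ≤-refl
    ... | false | true  = ≤-refl
    ... | false | false = ≤-refl
    open ≤-Reasoning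
    size : suc k ≤ ∑[ x < N ] χ (B x)
    size = begin
      suc k                                      ≤⟨ s≤s k≤h ⟩
      1 + h v                                    ≡⟨ cong (_+ h v) (∑-δ w) ⟨
      ∑[ x < N ] χ (δ x w) + h v                 ≡⟨ ∑-distrib-+ (λ x → χ (δ x w)) (λ x → χ (H v x)) ⟨
      ∑[ x < N ] (χ (δ x w) + χ (H v x))         ≤⟨ ∑-mono-≤ pointwise ⟩
      ∑[ x < N ] χ (B x)                         ∎
    member : ∀ {x} → B x ≡ true → H v x ≡ true ⊎ x ≡ w
    member {x} Bx with H v x
    ... | true  = inj₁ refl
    ... | false = inj₂ (δ-≡ Bx)
    clique : Clique B
    clique Bx By xy with member Bx | member By
    ... | inj₁ vx   | inj₁ vy   = neighbourhood-clique v vx vy xy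
    ... | inj₁ vx   | inj₂ refl = sep _ (H-sym xy) vx
    ... | inj₂ refl | inj₁ vy   = sep _ xy vy
    ... | inj₂ refl | inj₂ refl = H-irrefl xy

  module _ (regular : ∀ v → h v ≡ k) where

    -- Along the path u, c, b, w the neighbourhoods of adjacent vertices are disjoint. So N(b), N(c)
    -- and N(w) ∩ N(u) are pairwise disjoint, and the first two take 2k of the 2k + 1 points.
    common-neighbours≤1 : ∀ {u c w b} → H u c ≡ true → H w b ≡ true → H c b ≡ true →
          ∑[ x < N ] χ (H w x ∧ H u x) ≤ 1
    common-neighbours≤1 {u} {c} {w} {b} uc wb cb = +-cancelˡ-≤ (k + k) _ _ (begin
      k + k + P            ≡⟨ cong₂ (λ i j → i + j + P) (regular b) (regular c) ⟨
      h b + h c + P        ≤⟨ ∑-+-+-bound (λ x → χ (H b x)) (λ x → χ (H c x)) (λ x → χ (H w x ∧ H u x)) 1 pointwise ⟩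
      N * 1                ≡⟨ lem k ⟩
      k + k + 1            ∎)
      where
      open ≤-Reasoning
      P = ∑[ x < N ] χ (H w x ∧ H u x)
      lem : ∀ k → suc (2 * k) * 1 ≡ k + k + 1
      lem = solve-∀
      ∧-both : ∀ {p q} → p ∧ q ≡ true → p ≡ true × q ≡ true
      ∧-both {true} {true} _ = refl , refl
      pointwise : ∀ x → χ (H b x) + χ (H c x) + χ (H w x ∧ H u x) ≤ 1
      pointwise x = χ-disjoint₃ (λ bx cx → H-free cb bx cx)
        (λ bx both → H-free wb bx (proj₁ (∧-both both)))
        (λ cx both → H-free uc cx (proj₂ (∧-both both)))

    uncovered-vertex : ∀ u c → ∃[ w ] ((H u w ≡ true → ⊥) × (H c w ≡ true → ⊥))
    uncovered-vertex u c with ∑-positive outside (+-cancelʳ-≤ (h u + h c) _ _ (begin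
        1 + (h u + h c)                                             ≡⟨ cong₂ (λ i j → 1 + (i + j)) (regular u) (regular c) ⟩
        1 + (k + k)                                                 ≡⟨ lem k ⟩
        N * 1                                                       ≡⟨ ∑-const N 1 ⟨
        ∑[ x < N ] 1                                                ≤⟨ ∑-mono-≤ pointwise ⟩
        ∑[ x < N ] (outside x + (χ (H u x) + χ (H c x)))            ≡⟨ ∑-distrib-+ outside (λ x → χ (H u x) + χ (H c x)) ⟩
        sum outside + ∑[ x < N ] (χ (H u x) + χ (H c x))            ≡⟨ cong (sum outside +_) (∑-distrib-+ (λ x → χ (H u x)) (λ x → χ (H c x))) ⟩
        sum outside + (h u + h c)                                   ∎))
      where
      open ≤-Reasoning
      outside : Fin N → ℕ
      outside x = χ (not (H u x) ∧ not (H c x))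
      lem : ∀ k → 1 + (k + k) ≡ suc (2 * k) * 1
      lem = solve-∀
      pointwise : ∀ x → 1 ≤ outside x + (χ (H u x) + χ (H c x))
      pointwise x with H u x | H c x
      ... | true  | _     = s≤s z≤n
      ... | false | true  = s≤s z≤n
      ... | false | false = s≤s z≤n
    ... | w , 0<χ = w , neither (H u w) (H c w) 0<χ
      where
      neither : ∀ p q → 0 < χ (not p ∧ not q) → (p ≡ true → ⊥) × (q ≡ true → ⊥)
      neither false false _ = (λ ()) , (λ ())

    -- The sets N(w), N(u), N(c) and {w} have total size 3k + 1 and overlap only in the common
    -- neighbours of w with u and with c. With at most two overlaps, 3k + 1 ≤ 2k + 3.
    few-common-neighbours⇒k≤2 : ∀ {u c w} → H u c ≡ true → (H u w ≡ true → ⊥) → (H c w ≡ true → ⊥) →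
                 ∑[ x < N ] χ (H w x ∧ H u x) ≤ 1 → ∑[ x < N ] χ (H w x ∧ H c x) ≤ 1 → k ≤ 2
    few-common-neighbours⇒k≤2 {u} {c} {w} uc u≁w c≁w few-u few-c = +-cancelʳ-≤ (2 * k + 1) _ _ (begin
      k + (2 * k + 1)                  ≡⟨ lem₁ k ⟩
      k + k + (k + 1)                  ≡⟨ cong₂ _+_ (cong₂ _+_ (regular w) (regular u)) (cong₂ _+_ (regular c) (∑-δ w)) ⟨
      h w + h u + (h c + sum (λ x → χ (δ x w)))
        ≡⟨ cong₂ _+_ (∑-distrib-+ (λ x → χ (H w x)) (λ x → χ (H u x))) (∑-distrib-+ (λ x → χ (H c x)) (λ x → χ (δ x w))) ⟨
      sum (λ x → χ (H w x) + χ (H u x)) + sum (λ x → χ (H c x) + χ (δ x w))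
        ≡⟨ ∑-distrib-+ (λ x → χ (H w x) + χ (H u x)) (λ x → χ (H c x) + χ (δ x w)) ⟨
      sum (λ x → χ (H w x) + χ (H u x) + (χ (H c x) + χ (δ x w)))  ≤⟨ ∑-mono-≤ pointwise ⟩
      sum (λ x → Pu x + Pc x + 1)      ≡⟨ ∑-distrib-+ (λ x → Pu x + Pc x) (λ _ → 1) ⟩
      sum (λ x → Pu x + Pc x) + sum {N} (λ _ → 1)   ≡⟨ cong₂ _+_ (∑-distrib-+ Pu Pc) (∑-const N 1) ⟩
      sum Pu + sum Pc + N * 1          ≤⟨ +-monoˡ-≤ (N * 1) (+-mono-≤ few-u few-c) ⟩
      1 + 1 + N * 1                    ≡⟨ lem₂ k ⟩
      2 + (2 * k + 1)                  ∎)
      where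
      open ≤-Reasoning
      Pu Pc : Fin N → ℕ
      Pu x = χ (H w x ∧ H u x)
      Pc x = χ (H w x ∧ H c x)
      lem₁ : ∀ k → k + (2 * k + 1) ≡ k + k + (k + 1)
      lem₁ = solve-∀
      lem₂ : ∀ k → 1 + 1 + suc (2 * k) * 1 ≡ 2 + (2 * k + 1)
      lem₂ = solve-∀
      cases : ∀ p q r d → (q ≡ true → r ≡ true → ⊥) → (d ≡ true → p ≡ true → ⊥) →
              (d ≡ true → q ≡ true → ⊥) → (d ≡ true → r ≡ true → ⊥) →
              χ p + χ q + (χ r + χ d) ≤ χ (p ∧ q) + χ (p ∧ r) + 1
      cases p     true  true  d     qr _  _  _  = ⊥-elim (qr refl refl)
      cases true  q     r     true  _  dp _  _  = ⊥-elim (dp refl refl)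
      cases p     true  r     true  _  _  dq _  = ⊥-elim (dq refl refl)
      cases p     q     true  true  _  _  _  dr = ⊥-elim (dr refl refl)
      cases false false false true  _  _  _  _  = ≤-refl
      cases true  true  false false _  _  _  _  = ≤-refl
      cases true  false true  false _  _  _  _  = ≤-refl
      cases true  false false false _  _  _  _  = ≤-refl
      cases false true  false false _  _  _  _  = ≤-refl
      cases false false true  false _  _  _  _  = ≤-refl
      cases false false false false _  _  _  _  = z≤n
      at-w : ∀ {x v} → (H v w ≡ true → ⊥) → δ x w ≡ true → H v x ≡ true → ⊥
      at-w {v = v} v≁w xw vx = v≁w (subst (λ y → H v y ≡ true) (δ-≡ xw) vx)
      pointwise : ∀ x → χ (H w x) + χ (H u x) + (χ (H c x) + χ (δ x w)) ≤ Pu x + Pc x + 1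
      pointwise x = cases (H w x) (H u x) (H c x) (δ x w)
        (λ ux cx → H-free uc cx ux) (at-w H-irrefl) (at-w u≁w) (at-w c≁w)

    common-neighbour? : ∀ w v → (∃[ a ] (H w a ≡ true × H v a ≡ true)) ⊎
                                (∀ x → H w x ≡ true → H v x ≡ true → ⊥)
    common-neighbour? w v with Fin.any? (λ a → (H w a ≟ᵇ true) ×-dec (H v a ≟ᵇ true))
    ... | yes a = inj₁ a
    ... | no ¬a = inj₂ λ x wx vx → ¬a (x , wx , vx)

    -- For an edge from `zero` to c, some w is adjacent to neither end. If w shares no neighbour
    -- with one of the ends, it enlarges the neighbourhood of that end. Otherwise `zero`, c, b, w, a
    -- form a 5-cycle, and its paths of length three limit the common neighbours on both sides.
    regular⇒large-clique : 3 ≤ k → LargeClique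
    regular⇒large-clique 3≤k
      with ∑-positive (λ x → χ (H zero x)) (≤-trans (≤-trans (s≤s z≤n) 3≤k) (≤-reflexive (sym (regular zero))))
    ... | c , 0<χ with uncovered-vertex zero c
    ...   | w , u≁w , c≁w with common-neighbour? w zero | common-neighbour? w c
    ...     | inj₂ sep | _ = extend-clique zero w (≤-reflexive (sym (regular zero))) u≁w sep
    ...     | _ | inj₂ sep = extend-clique c w (≤-reflexive (sym (regular c))) c≁w sep
    ...     | inj₁ (a , wa , ua) | inj₁ (b , wb , cb) = contradiction
      (few-common-neighbours⇒k≤2 uc u≁w c≁w (common-neighbours≤1 uc wb cb) (common-neighbours≤1 (H-sym uc) wa ua)) (<⇒≱ 3≤k)
      where
      uc : H zero c ≡ true
      uc = χ-positive (H zero c) 0<χ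

  large-clique : 3 ≤ k → (∀ v → k ≤ h v) → LargeClique
  large-clique 3≤k k≤h with Fin.any? (λ v → suc k ≤? h v)
  ... | yes (v , k<h) = H v , k<h , neighbourhood-clique v
  ... | no ¬k<h       = regular⇒large-clique (λ v → ≤-antisym (≮⇒≥ λ k<h → ¬k<h (v , k<h)) (k≤h v)) 3≤k

-- Families of triples

∣p∣≡∑ : (p : Subset n) → ∑[ v < n ] χ (lookup p v) ≡ ∣ p ∣
∣p∣≡∑ []          = refl
∣p∣≡∑ (true ∷ p)  = cong suc (∣p∣≡∑ p)
∣p∣≡∑ (false ∷ p) = ∣p∣≡∑ p

∑ˡ : List A → (A → ℕ) → ℕ
∑ˡ xs f = sumˡ (List.map f xs)

∑ˡ-cong : (xs : List A) {f g : A → ℕ} → (∀ x → f x ≡ g x) → ∑ˡ xs f ≡ ∑ˡ xs g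
∑ˡ-cong []       f≡g = refl
∑ˡ-cong (x ∷ xs) f≡g = cong₂ _+_ (f≡g x) (∑ˡ-cong xs f≡g)

∑-∑ˡ-comm : (xs : List A) (f : A → Fin n → ℕ) →
            ∑[ v < n ] ∑ˡ xs (λ x → f x v) ≡ ∑ˡ xs (λ x → sum (f x))
∑-∑ˡ-comm {n = n} []       f = trans (∑-const n 0) (*-zeroʳ n)
∑-∑ˡ-comm {n = n} (x ∷ xs) f = trans (∑-distrib-+ (f x) (λ v → ∑ˡ xs (λ x → f x v)))
                             (cong (sum (f x) +_) (∑-∑ˡ-comm xs f))

∑ˡ-*ʳ : (xs : List A) (f : A → ℕ) (c : ℕ) → ∑ˡ xs (λ x → f x * c) ≡ ∑ˡ xs f * c
∑ˡ-*ʳ []       f c = refl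
∑ˡ-*ʳ (x ∷ xs) f c = trans (cong (f x * c +_) (∑ˡ-*ʳ xs f c)) (sym (*-distribʳ-+ c (f x) (∑ˡ xs f)))

∑ˡ-const : (xs : List A) (c : ℕ) → ∑ˡ xs (λ _ → c) ≡ length xs * c
∑ˡ-const []       c = refl
∑ˡ-const (x ∷ xs) c = cong (c +_) (∑ˡ-const xs c)

∑ˡ-member : {xs : List A} {x : A} (f : A → ℕ) → x ∈ xs → f x ≤ ∑ˡ xs f
∑ˡ-member f (here refl) = m≤m+n (f _) _
∑ˡ-member f (there x∈) = ≤-trans (∑ˡ-member f x∈) (m≤n+m _ (f _))

∑ˡ-∣ : (d : ℕ) (xs : List A) (f : A → ℕ) → (∀ {x} → x ∈ xs → d ∣ f x) → d ∣ ∑ˡ xs f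
∑ˡ-∣ d []       f d∣ = d ∣0
∑ˡ-∣ d (x ∷ xs) f d∣ = ∣m∣n⇒∣m+n (d∣ (here refl)) (∑ˡ-∣ d xs f (d∣ ∘ there))

χ-idem : ∀ b → χ b * χ b ≡ χ b
χ-idem true  = refl
χ-idem false = refl

χ*χ-positive : ∀ p q → 0 < χ p * χ q → p ≡ true × q ≡ true
χ*χ-positive true true _ = refl , refl

δ-≢ : ∀ {u v : Fin n} → δ u v ≡ false → u ≢ v
δ-≢ {u = u} eq refl with () ← trans (sym eq) (δ-refl u)

member : KSubset n 3 → Fin n → Bool
member q = lookup (proj₁ q)

triples-through : List (KSubset n 3) → Fin n → ℕ
triples-through D v = ∑ˡ D λ q → χ (member q v)

codegree : List (KSubset n 3) → Fin n → Fin n → ℕ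
codegree D u v = ∑ˡ D λ q → χ (member q u) * χ (member q v)

NoUncoveredTriangle : List (KSubset n 3) → Set
NoUncoveredTriangle D = ∀ {x y z} → x ≢ y → y ≢ z → x ≢ z →
  codegree D x y ≡ 0 → codegree D y z ≡ 0 → codegree D x z ≡ 0 → ⊥

∑-member : (q : KSubset n 3) → ∑[ v < n ] χ (member q v) ≡ 3
∑-member (p , ∣p∣≡3) = trans (∣p∣≡∑ p) ∣p∣≡3

∑-triples-through : (D : List (KSubset n 3)) → sum (triples-through D) ≡ length D * 3
∑-triples-through D = begin
  sum (triples-through D)                        ≡⟨ ∑-∑ˡ-comm D (λ q v → χ (member q v)) ⟩
  ∑ˡ D (λ q → ∑[ v < _ ] χ (member q v))         ≡⟨ ∑ˡ-cong D ∑-member ⟩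
  ∑ˡ D (λ _ → 3)                                 ≡⟨ ∑ˡ-const D 3 ⟩
  length D * 3                                   ∎
  where open ≡-Reasoning

∑-codegree : (D : List (KSubset n 3)) (v : Fin n) → sum (codegree D v) ≡ triples-through D v * 3
∑-codegree D v = begin
  sum (codegree D v)
    ≡⟨ ∑-∑ˡ-comm D (λ q u → χ (member q v) * χ (member q u)) ⟩
  ∑ˡ D (λ q → ∑[ u < _ ] (χ (member q v) * χ (member q u)))
    ≡⟨ ∑ˡ-cong D (λ q → sym (*-distribˡ-sum (χ (member q v)) (λ u → χ (member q u)))) ⟩
  ∑ˡ D (λ q → χ (member q v) * ∑[ u < _ ] χ (member q u))
    ≡⟨ ∑ˡ-cong D (λ q → cong (χ (member q v) *_) (∑-member q)) ⟩
  ∑ˡ D (λ q → χ (member q v) * 3)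
    ≡⟨ ∑ˡ-*ʳ D (λ q → χ (member q v)) 3 ⟩
  triples-through D v * 3  ∎
  where open ≡-Reasoning

codegree-refl : (D : List (KSubset n 3)) (v : Fin n) → codegree D v v ≡ triples-through D v
codegree-refl D v = ∑ˡ-cong D λ q → χ-idem (member q v)

codegree-sym : (D : List (KSubset n 3)) (u v : Fin n) → codegree D u v ≡ codegree D v u
codegree-sym D u v = ∑ˡ-cong D λ q → *-comm (χ (member q u)) (χ (member q v))

-- The lower bound for families without an uncovered triangle

module LowerBound (k : ℕ) (D : List (KSubset (suc (2 * k)) 3)) (free : NoUncoveredTriangle D) where

  private
    N : ℕ
    N = suc (2 * k)

  r : Fin N → ℕ
  r = triples-through D

  H : Fin N → Fin N → Bool
  H u v = not (δ u v) ∧ (codegree D u v ≡ᵇ 0)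

  H⁻ : ∀ {u v} → H u v ≡ true → u ≢ v × codegree D u v ≡ 0
  H⁻ {u} {v} uv with δ u v in eq | codegree D u v
  ... | false | zero = δ-≢ eq , refl

  H⁺ : ∀ {u v} → u ≢ v → codegree D u v ≡ 0 → H u v ≡ true
  H⁺ {u} {v} u≢v c≡0 with δ u v in eq
  ... | true = contradiction (δ-≡ eq) u≢v
  ... | false rewrite c≡0 = refl

  H-sym : ∀ {u v} → H u v ≡ true → H v u ≡ true
  H-sym {u} {v} uv = let u≢v , c≡0 = H⁻ uv in H⁺ (u≢v ∘ sym) (trans (codegree-sym D v u) c≡0)

  H-irrefl : ∀ {v} → H v v ≡ true → ⊥
  H-irrefl vv = proj₁ (H⁻ vv) refl

  H-free : ∀ {u v w} → H u v ≡ true → H v w ≡ true → H u w ≡ true → ⊥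
  H-free uv vw uw = let u≢v , uv≡0 = H⁻ uv ; v≢w , vw≡0 = H⁻ vw ; u≢w , uw≡0 = H⁻ uw in
    free u≢v v≢w u≢w uv≡0 vw≡0 uw≡0

  open TriangleFree k H H-sym H-irrefl H-free

  uncovered-or-linked : ∀ {u v} → u ≢ v → 1 ≤ χ (H u v) + codegree D u v
  uncovered-or-linked {u} {v} u≢v with H u v in eq
  ... | true  = s≤s z≤n
  ... | false = n≢0⇒n>0 λ c≡0 → contradiction (trans (sym eq) (H⁺ u≢v c≡0)) λ ()

  -- Each triple through v links v to two other points, and every point not reached in this way is
  -- an H-neighbour. The diagonal entry of `codegree` is r v instead of 0, so r v is added on both
  -- sides.
  degree : ∀ v → N ≤ suc (h v + 2 * r v)
  degree v = +-cancelʳ-≤ (r v) _ _ (begin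
    N + r v                                        ≡⟨ cong₂ _+_ (*-identityʳ N) (*-identityʳ (r v)) ⟨
    N * 1 + r v * 1                                ≡⟨ cong₂ (λ i j → i + r v * j) (∑-const N 1) (∑-δ v) ⟨
    sum {N} (λ _ → 1) + r v * sum (λ u → χ (δ u v))
      ≡⟨ cong (sum {N} (λ _ → 1) +_) (*-distribˡ-sum (r v) (λ u → χ (δ u v))) ⟩
    sum {N} (λ _ → 1) + sum (λ u → r v * χ (δ u v))    ≡⟨ ∑-distrib-+ (λ _ → 1) (λ u → r v * χ (δ u v)) ⟨
    sum (λ u → 1 + r v * χ (δ u v))                ≤⟨ ∑-mono-≤ pointwise ⟩
    sum (λ u → χ (δ u v) + χ (H v u) + codegree D v u)
      ≡⟨ ∑-distrib-+ (λ u → χ (δ u v) + χ (H v u)) (codegree D v) ⟩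
    sum (λ u → χ (δ u v) + χ (H v u)) + sum (codegree D v)
      ≡⟨ cong₂ _+_ (∑-distrib-+ (λ u → χ (δ u v)) (λ u → χ (H v u))) (∑-codegree D v) ⟩
    sum (λ u → χ (δ u v)) + h v + r v * 3          ≡⟨ cong (λ i → i + h v + r v * 3) (∑-δ v) ⟩
    1 + h v + r v * 3                              ≡⟨ lem (h v) (r v) ⟩
    suc (h v + 2 * r v) + r v                      ∎)
    where
    open ≤-Reasoning
    lem : ∀ h r → 1 + h + r * 3 ≡ suc (h + 2 * r) + r
    lem = solve-∀
    pointwise : ∀ u → 1 + r v * χ (δ u v) ≤ χ (δ u v) + χ (H v u) + codegree D v u
    pointwise u with u Fin.≟ v
    ... | yes refl = s≤s (≤-trans (≤-reflexive (trans (*-identityʳ (r v)) (sym (codegree-refl D v)))) (m≤n+m _ (χ (H v v))))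
    ... | no u≢v   = ≤-trans (≤-reflexive (cong suc (*-zeroʳ (r v)))) (uncovered-or-linked (u≢v ∘ sym))

  open Mantel r degree

  lower-bound : N * k ≤ 6 * length D
  lower-bound = ≤-trans nk≤2∑r (≤-reflexive (trans (cong (2 *_) (∑-triples-through D)) (lem (length D))))
    where
    lem : ∀ l → 2 * (l * 3) ≡ 6 * l
    lem = solve-∀

  -- In the equality case a clique of k + 1 covered pairs is a union of triples of D, each of them
  -- either inside the clique or disjoint from it.
  module Tight (2r≡k : ∀ v → 2 * r v ≡ k) (B : Fin (suc (2 * k)) → Bool)
               (large : suc k ≤ ∑[ x < suc (2 * k) ] χ (B x))
               (clique : Clique B) where

    size : ℕ
    size = ∑[ x < N ] χ (B x)

    inner : Fin N → Fin N → ℕ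
    inner b u = χ (B u) * codegree D b u

    inner≤ : ∀ b u → inner b u ≤ codegree D b u
    inner≤ b u = ≤-trans (*-monoˡ-≤ (codegree D b u) (χ≤1 (B u))) (≤-reflexive (*-identityˡ _))

    -- Each of the other points of B is linked to b at least once, and b itself contributes r b
    -- through the diagonal.
    inner-≥ : ∀ {b} → B b ≡ true → size + r b ≤ 1 + sum (inner b)
    inner-≥ {b} Bb = begin
      size + r b                                          ≡⟨ cong (size +_) (*-identityʳ (r b)) ⟨
      size + r b * 1                                      ≡⟨ cong (λ i → size + r b * i) (∑-δ b) ⟨
      size + r b * sum (λ u → χ (δ u b))                  ≡⟨ cong (size +_) (*-distribˡ-sum (r b) (λ u → χ (δ u b))) ⟩
      size + sum (λ u → r b * χ (δ u b))                  ≡⟨ ∑-distrib-+ (λ u → χ (B u)) (λ u → r b * χ (δ u b)) ⟨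
      sum (λ u → χ (B u) + r b * χ (δ u b))               ≤⟨ ∑-mono-≤ pointwise ⟩
      sum (λ u → χ (δ u b) + inner b u)                   ≡⟨ ∑-distrib-+ (λ u → χ (δ u b)) (inner b) ⟩
      sum (λ u → χ (δ u b)) + sum (inner b)               ≡⟨ cong (_+ sum (inner b)) (∑-δ b) ⟩
      1 + sum (inner b)                                   ∎
      where
      open ≤-Reasoning
      pointwise : ∀ u → χ (B u) + r b * χ (δ u b) ≤ χ (δ u b) + inner b u
      pointwise u with u Fin.≟ b
      ... | yes refl = begin
        χ (B b) + r b * 1              ≡⟨ cong₂ (λ i j → χ i + j) Bb (*-identityʳ (r b)) ⟩
        1 + r b                        ≡⟨ cong suc (codegree-refl D b) ⟨
        1 + codegree D b b             ≡⟨ cong suc (*-identityˡ (codegree D b b)) ⟨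
        1 + 1 * codegree D b b         ≡⟨ cong (λ i → 1 + χ i * codegree D b b) Bb ⟨
        1 + χ (B b) * codegree D b b   ∎
      ... | no u≢b with B u in Bu
      ...   | false = ≤-reflexive (*-zeroʳ (r b))
      ...   | true  = begin
        1 + r b * 0                    ≡⟨ cong suc (*-zeroʳ (r b)) ⟩
        1                              ≤⟨ uncovered-or-linked (u≢b ∘ sym) ⟩
        χ (H b u) + codegree D b u     ≡⟨ cong (λ i → χ i + codegree D b u) (¬-not (clique Bb Bu)) ⟩
        codegree D b u                 ≡⟨ *-identityˡ (codegree D b u) ⟨
        1 * codegree D b u             ∎

    lem : ∀ r → 1 + 2 * r + r ≡ 1 + r * 3
    lem = solve-∀

    size≤ : ∀ {b} → B b ≡ true → size ≤ suc k
    size≤ {b} Bb = +-cancelʳ-≤ (r b) _ _ (begin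
      size + r b               ≤⟨ inner-≥ Bb ⟩
      1 + sum (inner b)        ≤⟨ s≤s (∑-mono-≤ (inner≤ b)) ⟩
      1 + sum (codegree D b)   ≡⟨ cong suc (∑-codegree D b) ⟩
      1 + r b * 3              ≡⟨ lem (r b) ⟨
      1 + 2 * r b + r b        ≡⟨ cong (λ i → 1 + i + r b) (2r≡k b) ⟩
      suc k + r b              ∎)
      where open ≤-Reasoning

    -- The codegrees at b add up to 3 r b = k + r b, which the points of B already exhaust. So no
    -- triple through a point of B leaves B.
    closed : ∀ {b} → B b ≡ true → ∀ u → inner b u ≡ codegree D b u
    closed {b} Bb = ∑-mono-≤-cancel (inner≤ b) (s≤s⁻¹ (begin
      1 + sum (codegree D b)   ≡⟨ cong suc (∑-codegree D b) ⟩
      1 + r b * 3              ≡⟨ lem (r b) ⟨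
      1 + 2 * r b + r b        ≡⟨ cong (λ i → 1 + i + r b) (2r≡k b) ⟩
      suc k + r b              ≤⟨ +-monoˡ-≤ (r b) large ⟩
      size + r b               ≤⟨ inner-≥ Bb ⟩
      1 + sum (inner b)        ∎))
      where open ≤-Reasoning

    inside : KSubset N 3 → ℕ
    inside q = ∑[ v < N ] (χ (B v) * χ (member q v))

    3∣inside : ∀ {q} → q ∈ D → 3 ∣ inside q
    3∣inside {q} q∈D with inside q in eq
    ... | zero  = 3 ∣0
    ... | suc _ with ∑-positive (λ v → χ (B v) * χ (member q v)) (subst (0 <_) (sym eq) z<s)
    ...   | b , pos = divides 1 (trans (sym eq) (trans (sum-cong-≗ all-inside) (∑-member q)))
      where
      Bb : B b ≡ true
      Bb = proj₁ (χ*χ-positive (B b) (member q b) pos)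
      qb : member q b ≡ true
      qb = proj₂ (χ*χ-positive (B b) (member q b) pos)
      all-inside : ∀ u → χ (B u) * χ (member q u) ≡ χ (member q u)
      all-inside u with B u in Bu
      ... | true  = *-identityˡ _
      ... | false with member q u in qu
      ...   | false = refl
      ...   | true  = contradiction
        (begin
          1                                    ≡⟨ cong₂ (λ i j → χ i * χ j) qb qu ⟨
          χ (member q b) * χ (member q u)      ≤⟨ ∑ˡ-member (λ q → χ (member q b) * χ (member q u)) q∈D ⟩
          codegree D b u                       ≡⟨ closed Bb u ⟨
          χ (B u) * codegree D b u             ≡⟨ cong (λ i → χ i * codegree D b u) Bu ⟩
          0                                    ∎) 1+n≰n
        where open ≤-Reasoning

    size≡ : size ≡ suc k
    size≡ with ∑-positive (λ x → χ (B x)) (≤-trans (s≤s z≤n) large)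
    ... | b , pos = ≤-antisym (size≤ (χ-positive (B b) pos)) large

    incidences : 2 * ∑ˡ D inside ≡ suc k * k
    incidences = begin
      2 * ∑ˡ D inside                          ≡⟨ cong (2 *_) (∑-∑ˡ-comm D (λ q v → χ (B v) * χ (member q v))) ⟨
      2 * sum (λ v → ∑ˡ D (λ q → χ (B v) * χ (member q v)))
        ≡⟨ *-distribˡ-sum 2 (λ v → ∑ˡ D (λ q → χ (B v) * χ (member q v))) ⟩
      sum (λ v → 2 * ∑ˡ D (λ q → χ (B v) * χ (member q v)))  ≡⟨ sum-cong-≗ pointwise ⟩
      sum (λ v → χ (B v) * k)                  ≡⟨ *-distribʳ-sum k (λ v → χ (B v)) ⟨
      size * k                                 ≡⟨ cong (_* k) size≡ ⟩
      suc k * k                                ∎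
      where
      open ≡-Reasoning
      lem′ : ∀ r b → 2 * (r * b) ≡ b * (2 * r)
      lem′ = solve-∀
      pointwise : ∀ v → 2 * ∑ˡ D (λ q → χ (B v) * χ (member q v)) ≡ χ (B v) * k
      pointwise v = begin
        2 * ∑ˡ D (λ q → χ (B v) * χ (member q v))   ≡⟨ cong (2 *_) (∑ˡ-cong D (λ q → *-comm (χ (B v)) _)) ⟩
        2 * ∑ˡ D (λ q → χ (member q v) * χ (B v))   ≡⟨ cong (2 *_) (∑ˡ-*ʳ D (λ q → χ (member q v)) (χ (B v))) ⟩
        2 * (r v * χ (B v))                         ≡⟨ lem′ (r v) (χ (B v)) ⟩
        χ (B v) * (2 * r v)                         ≡⟨ cong (χ (B v) *_) (2r≡k v) ⟩
        χ (B v) * k                                 ∎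

    6∣k[k+1] : 6 ∣ suc k * k
    6∣k[k+1] = subst (6 ∣_) incidences (*-monoʳ-∣ 2 (∑ˡ-∣ 3 D inside 3∣inside))

  strict-lower-bound : 3 ≤ k → ¬ 6 ∣ suc k * k → N * k < 6 * length D
  strict-lower-bound 3≤k 6∤ with N * k <? 6 * length D
  ... | yes lt = lt
  ... | no ≮ = contradiction (Tight.6∣k[k+1] 2r≡k (proj₁ B) (proj₁ (proj₂ B)) (proj₂ (proj₂ B))) 6∤
    where
    lem : ∀ l → 2 * (l * 3) ≡ 6 * l
    lem = solve-∀
    2r≡k : ∀ v → 2 * r v ≡ k
    2r≡k = equality (≤-trans (s≤s z≤n) 3≤k)
      (≤-trans (≤-reflexive (trans (cong (2 *_) (∑-triples-through D)) (lem (length D)))) (≮⇒≥ ≮))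
    B : LargeClique
    B = large-clique 3≤k λ v → +-cancelʳ-≤ (suc k) _ _ (≤-trans (≤-reflexive (lem′ k))
      (≤-trans (degree v) (≤-reflexive (trans (cong (λ i → suc (h v + i)) (2r≡k v)) (sym (+-suc (h v) k))))))
      where
      lem′ : ∀ k → k + suc k ≡ suc (2 * k)
      lem′ = solve-∀

-- Coverings of complete graphs

-- The three points need not be distinct; triangle-⊇ repairs degenerate triples.
Triple : Set → Set
Triple A = A × A × A

_∈₃_ : A → Triple A → Set
u ∈₃ (x , y , z) = u ≡ x ⊎ u ≡ y ⊎ u ≡ z

map₃ : (A → A′) → Triple A → Triple A′
map₃ f (x , y , z) = f x , f y , f z

∈₃-map : (f : A → A′) {u : A} {t : Triple A} → u ∈₃ t → f u ∈₃ map₃ f t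
∈₃-map f (inj₁ eq)        = inj₁ (cong f eq)
∈₃-map f (inj₂ (inj₁ eq)) = inj₂ (inj₁ (cong f eq))
∈₃-map f (inj₂ (inj₂ eq)) = inj₂ (inj₂ (cong f eq))

pattern 1st = inj₁ refl
pattern 2nd = inj₂ (inj₁ refl)
pattern 3rd = inj₂ (inj₂ refl)

Joined : (I → Triple A) → A → A → Set
Joined block u v = ∃[ i ] (u ∈₃ block i × v ∈₃ block i)

joined-sym : {block : I → Triple A} {u v : A} → Joined block u v → Joined block v u
joined-sym (i , u∈ , v∈) = i , v∈ , u∈

joined-map : {block : I → Triple A} (f : A → A′) {u v : A} → Joined block u v → Joined (map₃ f ∘ block) (f u) (f v)
joined-map f (i , u∈ , v∈) = i , ∈₃-map f u∈ , ∈₃-map f v∈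

joined-inj₁ : {s : I → Triple A} {t : J → Triple A} {u v : A} → Joined s u v → Joined [ s , t ] u v
joined-inj₁ (i , u∈ , v∈) = inj₁ i , u∈ , v∈

joined-inj₂ : {s : I → Triple A} {t : J → Triple A} {u v : A} → Joined t u v → Joined [ s , t ] u v
joined-inj₂ (i , u∈ , v∈) = inj₂ i , u∈ , v∈

Covers : (I → Triple A) → Set
Covers block = ∀ u v → u ≢ v → Joined block u v

-- The number of triples is carried by the index type. Repeated triples do no harm, because a
-- covering only has to give an upper bound.
Covering : Set → Set → Set
Covering A I = Σ (I → Triple A) Covers

transport : A ↔ A′ → I ↔ J → Covering A I → Covering A′ J
transport {A = A} e f (block , covers) = block′ , covers′
  where
  open Inverse
  block′ = λ j → map₃ (to e) (block (from f j))
  covers′ : Covers block′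
  covers′ u v u≢v with covers (from e u) (from e v)
    (λ eq → u≢v (trans (sym (strictlyInverseˡ e u)) (trans (cong (to e) eq) (strictlyInverseˡ e v))))
  ... | i , u∈ , v∈ = to f i , lift u∈ , lift v∈
    where
    lift : ∀ {w} → from e w ∈₃ block i → w ∈₃ block′ (to f i)
    lift {w} w∈ = subst₂ (λ x j → x ∈₃ map₃ (to e) (block j)) (strictlyInverseˡ e w)
                         (sym (strictlyInverseʳ f i)) (∈₃-map (to e) w∈)

-- The number q(q - 1)/2 of unordered pairs, in the recursion that `pair` follows: first the pairs
-- containing `zero`, then the others.
tri : ℕ → ℕ
tri zero    = 0
tri (suc q) = q + tri q

tri-odd : ∀ n → tri (1 + n * 2) ≡ n * (1 + n * 2)
tri-odd zero    = refl
tri-odd (suc n) = trans (cong (λ i → 2 + n * 2 + (1 + n * 2 + i)) (tri-odd n)) (lem n)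
  where
  lem : ∀ n → 2 + n * 2 + (1 + n * 2 + n * (1 + n * 2)) ≡ (1 + n) * (1 + (1 + n) * 2)
  lem = solve-∀

pair : ∀ q → Fin (tri q) → Fin q × Fin q
pair (suc q) i = [ (λ y → zero , suc y) , map suc suc ∘ pair q ] (splitAt q i)

pair-complete : ∀ {q} (x y : Fin q) → x ≢ y → ∃[ i ] (pair q i ≡ (x , y) ⊎ pair q i ≡ (y , x))
pair-complete zero zero x≢y = contradiction refl x≢y
pair-complete {suc q} zero (suc y) _ = y ↑ˡ tri q , inj₁ (cong [ _ , _ ] (Fin.splitAt-↑ˡ q y (tri q)))
pair-complete {suc q} (suc x) zero _ = x ↑ˡ tri q , inj₂ (cong [ _ , _ ] (Fin.splitAt-↑ˡ q x (tri q)))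
pair-complete {suc q} (suc x) (suc y) x≢y with pair-complete x y (x≢y ∘ cong suc)
... | i , inj₁ eq = q ↑ʳ i , inj₁ (trans (cong [ _ , _ ] (Fin.splitAt-↑ʳ q (tri q) i)) (cong (map suc suc) eq))
... | i , inj₂ eq = q ↑ʳ i , inj₂ (trans (cong [ _ , _ ] (Fin.splitAt-↑ʳ q (tri q) i)) (cong (map suc suc) eq))

-- Commutative quasigroups of odd and even order

-- The factor c is n + 1 for the quasigroup of odd order and 1 for that of even order.
%-absorb : ∀ c a b q .{{_ : NonZero q}} → (c * (a + b % q)) % q ≡ (c * (a + b)) % q
%-absorb c a b q = begin
  (c * (a + b % q)) % q                         ≡⟨ [m+kn]%n≡m%n (c * (a + b % q)) (c * (b / q)) q ⟨
  (c * (a + b % q) + c * (b / q) * q) % q       ≡⟨ cong (_% q) (lem c a (b % q) (b / q) q) ⟩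
  (c * (a + (b % q + b / q * q))) % q           ≡⟨ cong (λ i → (c * (a + i)) % q) (m≡m%n+[m/n]*n b q) ⟨
  (c * (a + b)) % q                             ∎
  where
  open ≡-Reasoning
  lem : ∀ c a r d q → c * (a + r) + c * d * q ≡ c * (a + (r + d * q))
  lem = solve-∀

toℕ-mod : ∀ a q .{{_ : NonZero q}} → toℕ (a mod q) ≡ a % q
toℕ-mod a q = Fin.toℕ-fromℕ< (m%n<n a q)

toℕ-% : ∀ {q} (x : Fin q) .{{_ : NonZero q}} → toℕ x % q ≡ toℕ x
toℕ-% x = m<n⇒m%n≡m (Fin.toℕ<n x)

record Quasigroup (Q : Set) : Set where
  infixl 7 _·_
  field
    _·_   : Q → Q → Q
    comm  : ∀ x y → x · y ≡ y · x
    solve : ∀ x z → ∃[ y ] x · y ≡ z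

module _ (n : ℕ) where

  private
    q : ℕ
    q = 1 + n * 2

    -- Multiplication by n + 1 is division by 2 modulo 2n + 1.
    mean : Fin q → Fin q → Fin q
    mean x y = (suc n * (toℕ x + toℕ y)) mod q

    mean-solve : ∀ x z → ∃[ y ] mean x y ≡ z
    mean-solve x z = y , Fin.toℕ-injective (begin
      toℕ (mean x y)                             ≡⟨ toℕ-mod (suc n * (toℕ x + toℕ y)) q ⟩
      (suc n * (toℕ x + toℕ y)) % q              ≡⟨ cong (λ i → (suc n * (toℕ x + i)) % q) (toℕ-mod w q) ⟩
      (suc n * (toℕ x + w % q)) % q              ≡⟨ %-absorb (suc n) (toℕ x) w q ⟩
      (suc n * (toℕ x + (2 * toℕ z + x̄))) % q    ≡⟨ cong (_% q) (lem₁ n (toℕ x) (toℕ z) x̄) ⟩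
      (suc n * (2 * toℕ z + (toℕ x + x̄))) % q    ≡⟨ cong (λ i → (suc n * (2 * toℕ z + i)) % q) (m+[n∸m]≡n (<⇒≤ (Fin.toℕ<n x))) ⟩
      (suc n * (2 * toℕ z + q)) % q              ≡⟨ cong (_% q) (lem₂ n (toℕ z)) ⟩
      (toℕ z + (toℕ z + suc n) * q) % q          ≡⟨ [m+kn]%n≡m%n (toℕ z) (toℕ z + suc n) q ⟩
      toℕ z % q                                  ≡⟨ toℕ-% z ⟩
      toℕ z                                      ∎)
      where
      open ≡-Reasoning
      -- This stands for -x modulo q, so that y is 2z - x, the reflection of x in z.
      x̄ = q ∸ toℕ x
      w = 2 * toℕ z + x̄
      y = w mod q
      lem₁ : ∀ n x z x̄ → suc n * (x + (2 * z + x̄)) ≡ suc n * (2 * z + (x + x̄))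
      lem₁ = solve-∀
      lem₂ : ∀ n z → suc n * (2 * z + (1 + n * 2)) ≡ z + (z + suc n) * (1 + n * 2)
      lem₂ = solve-∀

  odd-quasigroup : Quasigroup (Fin q)
  odd-quasigroup = record
    { _·_   = mean
    ; comm  = λ x y → cong (λ i → (suc n * i) mod q) (+-comm (toℕ x) (toℕ y))
    ; solve = mean-solve
    }

  odd-idempotent : ∀ x → Quasigroup._·_ odd-quasigroup x x ≡ x
  odd-idempotent x = Fin.toℕ-injective (begin
    toℕ (mean x x)                       ≡⟨ toℕ-mod (suc n * (toℕ x + toℕ x)) q ⟩
    (suc n * (toℕ x + toℕ x)) % q        ≡⟨ cong (_% q) (lem n (toℕ x)) ⟩
    (toℕ x + toℕ x * q) % q              ≡⟨ [m+kn]%n≡m%n (toℕ x) (toℕ x) q ⟩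
    toℕ x % q                            ≡⟨ toℕ-% x ⟩
    toℕ x                                ∎)
    where
    open ≡-Reasoning
    lem : ∀ n x → suc n * (x + x) ≡ x + x * (1 + n * 2)
    lem = solve-∀

module _ (n-1 : ℕ) where

  private
    N q : ℕ
    N = suc n-1
    q = N * 2

    value : Fin N × Fin 2 → ℕ
    value (a , b) = N * toℕ b + toℕ a

    -- In `value` the bit b is the leading digit, so it is read off by `combine b a`; this accounts
    -- for the cast between N * 2 and 2 * N.
    value-surjective : (y : Fin q) → ∃[ x ] value x ≡ toℕ y
    value-surjective y with remQuot {2} N (cast (*-comm N 2) y) in eq
    ... | b , a = (a , b) , (begin
      N * toℕ b + toℕ a                                       ≡⟨ Fin.toℕ-combine b a ⟨
      toℕ (combine b a)                                       ≡⟨ cong (λ (i , j) → toℕ (combine i j)) eq ⟨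
      toℕ (let i , j = remQuot {2} N y′ in combine i j)       ≡⟨ cong toℕ (Fin.combine-remQuot {2} N y′) ⟩
      toℕ y′                                                  ≡⟨ Fin.toℕ-cast _ y ⟩
      toℕ y                                                   ∎)
      where
      open ≡-Reasoning
      y′ = cast (*-comm N 2) y

    value≤ : ∀ x → value x ≤ q
    value≤ (a , b) = <⇒≤ (subst₂ _<_ (Fin.toℕ-combine b a) (*-comm 2 N) (Fin.toℕ<n (combine b a)))

    -- Addition modulo 2N followed by a relabelling of the sums. The factor 1 gives the sum the
    -- shape of `%-absorb`.
    half : Fin N × Fin 2 → Fin N × Fin 2 → Fin N × Fin 2
    half x y = remQuot 2 ((1 * (value x + value y)) mod q)

    half-solve : ∀ x z → ∃[ y ] half x y ≡ z
    half-solve x z with value-surjective ((toℕ (combine (proj₁ z) (proj₂ z)) + (q ∸ value x)) mod q)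
    ... | y , eq = y , trans (cong (remQuot 2) (Fin.toℕ-injective (begin
      toℕ ((1 * (value x + value y)) mod q)     ≡⟨ toℕ-mod (1 * (value x + value y)) q ⟩
      (1 * (value x + value y)) % q             ≡⟨ cong (λ i → (1 * (value x + i)) % q) (trans eq (toℕ-mod (s + x̄) q)) ⟩
      (1 * (value x + (s + x̄) % q)) % q         ≡⟨ %-absorb 1 (value x) (s + x̄) q ⟩
      (1 * (value x + (s + x̄))) % q             ≡⟨ cong (_% q) (lem (value x) s x̄) ⟩
      (s + (value x + x̄)) % q                   ≡⟨ cong (λ i → (s + i) % q) (m+[n∸m]≡n (value≤ x)) ⟩
      (s + q) % q                               ≡⟨ cong (λ i → (s + i) % q) (*-identityˡ q) ⟨
      (s + 1 * q) % q                           ≡⟨ [m+kn]%n≡m%n s 1 q ⟩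
      s % q                                     ≡⟨ toℕ-% (combine (proj₁ z) (proj₂ z)) ⟩
      s                                         ∎))) (Fin.remQuot-combine (proj₁ z) (proj₂ z))
      where
      open ≡-Reasoning
      s = toℕ (combine (proj₁ z) (proj₂ z))
      x̄ = q ∸ value x
      lem : ∀ x s x̄ → 1 * (x + (s + x̄)) ≡ s + (x + x̄)
      lem = solve-∀

  -- (a , b) stands for the residue a + bn modulo 2n on the left of ·, and for 2a + b when it is
  -- read off a sum.
  even-quasigroup : Quasigroup (Fin N × Fin 2)
  even-quasigroup = record
    { _·_   = half
    ; comm  = λ x y → cong (λ i → remQuot 2 ((1 * i) mod q)) (+-comm (value x) (value y))
    ; solve = half-solve
    }

  -- Doubling a + bN loses the bit b modulo 2N, and the remaining 2a is relabelled as (a , 0). An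
  -- idempotent commutative quasigroup of even order does not exist; half of the elements being
  -- idempotent is the substitute.
  even-half-idempotent : ∀ a b → Quasigroup._·_ even-quasigroup (a , b) (a , b) ≡ (a , 0F)
  even-half-idempotent a b = trans (cong (remQuot 2) (Fin.toℕ-injective (begin
    toℕ ((1 * (value (a , b) + value (a , b))) mod q)     ≡⟨ toℕ-mod (1 * (value (a , b) + value (a , b))) q ⟩
    (1 * (value (a , b) + value (a , b))) % q             ≡⟨ cong (_% q) (lem N (toℕ a) (toℕ b)) ⟩
    (2 * toℕ a + 0 + toℕ b * q) % q                       ≡⟨ [m+kn]%n≡m%n (2 * toℕ a + 0) (toℕ b) q ⟩
    (2 * toℕ a + 0) % q                                   ≡⟨ cong (_% q) (Fin.toℕ-combine a 0F) ⟨
    toℕ (combine a 0F) % q                                ≡⟨ toℕ-% (combine a 0F) ⟩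
    toℕ (combine a 0F)                                    ∎))) (Fin.remQuot-combine a 0F)
    where
    open ≡-Reasoning
    lem : ∀ N a b → 1 * (N * b + a + (N * b + a)) ≡ 2 * a + 0 + b * (N * 2)
    lem = solve-∀

-- Triples on three cyclically ordered levels

next : Fin 3 → Fin 3
next 0F = 1F
next 1F = 2F
next 2F = 0F

compare₃ : ∀ i j → i ≡ j ⊎ j ≡ next i ⊎ i ≡ next j
compare₃ 0F 0F = inj₁ refl
compare₃ 0F 1F = inj₂ (inj₁ refl)
compare₃ 0F 2F = inj₂ (inj₂ refl)
compare₃ 1F 0F = inj₂ (inj₂ refl)
compare₃ 1F 1F = inj₁ refl
compare₃ 1F 2F = inj₂ (inj₁ refl)
compare₃ 2F 0F = inj₂ (inj₁ refl)
compare₃ 2F 1F = inj₂ (inj₂ refl)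
compare₃ 2F 2F = inj₁ refl

module Layers {q : ℕ} {Q : Set} (e : Q ↔ Fin q) (quasi : Fin 3 → Quasigroup Q) where

  open Inverse e

  _·[_]_ : Q → Fin 3 → Q → Q
  x ·[ i ] y = Quasigroup._·_ (quasi i) x y

  _≟ᵠ_ : DecidableEquality Q
  _≟ᵠ_ = Fin.inj⇒≟ (↔⇒↣ e)

  -- The mixed triples of Bose and Skolem. The product may depend on the level, which `Hole` uses to
  -- twist the last step of the cycle.
  layer : Fin 3 × Fin (tri q) → Triple (Fin 3 × Q)
  layer (i , k) = let x , y = pair q k in (i , from x) , (i , from y) , (next i , from x ·[ i ] from y)

  layer-of-pair : ∀ i {x y} → x ≢ y → ∃[ k ]
    (layer k ≡ ((i , x) , (i , y) , (next i , x ·[ i ] y)) ⊎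
     layer k ≡ ((i , y) , (i , x) , (next i , x ·[ i ] y)))
  layer-of-pair i {x} {y} x≢y with pair-complete (to x) (to y)
    (λ eq → x≢y (trans (sym (strictlyInverseʳ x)) (trans (cong from eq) (strictlyInverseʳ y))))
  ... | k , inj₁ eq = (i , k) , inj₁ (trans (cong (λ (x , y) → (i , from x) , (i , from y) , (next i , from x ·[ i ] from y)) eq)
          (cong₂ (λ x y → (i , x) , (i , y) , (next i , x ·[ i ] y)) (strictlyInverseʳ x) (strictlyInverseʳ y)))
  ... | k , inj₂ eq = (i , k) , inj₂ (trans (cong (λ (x , y) → (i , from x) , (i , from y) , (next i , from x ·[ i ] from y)) eq)
          (trans (cong₂ (λ x y → (i , y) , (i , x) , (next i , y ·[ i ] x)) (strictlyInverseʳ x) (strictlyInverseʳ y))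
                 (cong (λ z → (i , y) , (i , x) , (next i , z)) (Quasigroup.comm (quasi i) y x))))

  same-layer : ∀ i {x y} → x ≢ y → Joined layer (i , x) (i , y)
  same-layer i {x} {y} x≢y with layer-of-pair i x≢y
  ... | k , inj₁ eq = k , subst ((i , x) ∈₃_) (sym eq) 1st , subst ((i , y) ∈₃_) (sym eq) 2nd
  ... | k , inj₂ eq = k , subst ((i , x) ∈₃_) (sym eq) 2nd , subst ((i , y) ∈₃_) (sym eq) 1st

  product-layer : ∀ i {x y} → x ≢ y → Joined layer (i , x) (next i , x ·[ i ] y)
  product-layer i {x} {y} x≢y with layer-of-pair i x≢y
  ... | k , inj₁ eq = k , subst ((i , x) ∈₃_) (sym eq) 1st , subst ((next i , x ·[ i ] y) ∈₃_) (sym eq) 3rd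
  ... | k , inj₂ eq = k , subst ((i , x) ∈₃_) (sym eq) 2nd , subst ((next i , x ·[ i ] y) ∈₃_) (sym eq) 3rd

  next-layer : ∀ i x z → Joined layer (i , x) (next i , z) ⊎ z ≡ x ·[ i ] x
  next-layer i x z with Quasigroup.solve (quasi i) x z
  ... | y , refl with x ≟ᵠ y
  ...   | yes refl = inj₂ refl
  ...   | no x≢y   = inj₁ (product-layer i x≢y)

  -- Solving x · y ≡ z joins x to z in the next layer unless y ≡ x, that is, unless z is the square of x.
  layers-cover : {block : I → Triple A} (ι : Fin 3 × Q → A) →
                 (∀ {u v} → Joined layer u v → Joined block (ι u) (ι v)) →
                 (∀ i x → Joined block (ι (i , x)) (ι (next i , x ·[ i ] x))) →
                 ∀ u v → ι u ≢ ι v → Joined block (ι u) (ι v)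
  layers-cover {block = block} ι lift square (i , x) (j , y) u≢v with compare₃ i j
  ... | inj₁ refl = lift (same-layer i λ { refl → u≢v refl })
  ... | inj₂ (inj₁ refl) with next-layer i x y
  ...   | inj₁ joined = lift joined
  ...   | inj₂ refl   = square i x
  layers-cover {block = block} ι lift square (i , x) (j , y) u≢v | inj₂ (inj₂ refl) with next-layer j y x
  ...   | inj₁ joined = joined-sym {block = block} (lift joined)
  ...   | inj₂ refl   = joined-sym {block = block} (square j y)

×-↔-* : ∀ {m n} {A B : Set} → A ↔ Fin m → B ↔ Fin n → (A × B) ↔ Fin (m * n)
×-↔-* e f = ↔-sym Fin.*↔× ↔-∘ (e ×-↔ f)

⊎-↔-+ : ∀ {m n} {A B : Set} → A ↔ Fin m → B ↔ Fin n → (A ⊎ B) ↔ Fin (m + n)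
⊎-↔-+ e f = ↔-sym Fin.+↔⊎ ↔-∘ (e ⊎-↔ f)

Fin↔ : ∀ {n} → Fin n ↔ Fin n
Fin↔ = ↔-id _

-- Bose's triple system on 6n + 3 points
module Bose (n : ℕ) where

  open Quasigroup (odd-quasigroup n)
  open Layers (Fin↔ {1 + n * 2}) (λ _ → odd-quasigroup n)

  column : Fin (1 + n * 2) → Triple (Fin 3 × Fin (1 + n * 2))
  column x = (0F , x) , (1F , x) , (2F , x)

  in-column : ∀ i x → (i , x) ∈₃ column x
  in-column 0F x = 1st
  in-column 1F x = 2nd
  in-column 2F x = 3rd

  covering : Covering (Fin 3 × Fin (1 + n * 2)) (Fin (1 + n * 2) ⊎ Fin 3 × Fin (tri (1 + n * 2)))
  covering = [ column , layer ] , layers-cover id joined-inj₂ square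
    where
    -- By idempotence the pairs left over by the layers are the vertical ones, and the columns
    -- contain exactly these.
    square : ∀ i x → Joined [ column , layer ] (i , x) (next i , x · x)
    square i x rewrite odd-idempotent n x = inj₁ x , in-column i x , in-column (next i) x

  finite-covering : Covering (Fin (3 * (1 + n * 2))) (Fin (1 + n * 2 + 3 * tri (1 + n * 2)))
  finite-covering = transport (×-↔-* Fin↔ Fin↔) (⊎-↔-+ Fin↔ (×-↔-* Fin↔ Fin↔)) covering

-- Skolem's triple system on 6n + 1 points
module Skolem (n-1 : ℕ) where

  private
    N : ℕ
    N = suc n-1

  Q : Set
  Q = Fin N × Fin 2

  open Quasigroup (even-quasigroup n-1)
  open Layers {q = N * 2} {Q} (×-↔-* Fin↔ Fin↔) (λ _ → even-quasigroup n-1)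

  Point : Set
  Point = Fin 1 ⊎ Fin 3 × Q

  pattern ∞ = inj₁ 0F

  column : Fin N → Triple Point
  column a = inj₂ (0F , a , 0F) , inj₂ (1F , a , 0F) , inj₂ (2F , a , 0F)

  in-column : ∀ i a → inj₂ (i , a , 0F) ∈₃ column a
  in-column 0F a = 1st
  in-column 1F a = 2nd
  in-column 2F a = 3rd

  -- The square of (a , 1) is (a , 0), so the layers miss the pair (i , a , 1), (i + 1 , a , 0). As
  -- i and a vary, these pairs form a perfect matching of the finite points, and ∞ completes each of
  -- them to a triple.
  infinite : Fin 3 × Fin N → Triple Point
  infinite (i , a) = ∞ , inj₂ (i , a , 1F) , inj₂ (next i , a , 0F)

  block : Fin N ⊎ Fin 3 × Fin N ⊎ Fin 3 × Fin (tri (N * 2)) → Triple Point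
  block = [ column , [ infinite , map₃ inj₂ ∘ layer ] ]

  ∞-joined : ∀ i x → Joined block ∞ (inj₂ (i , x))
  ∞-joined 0F (a , 0F) = inj₂ (inj₁ (2F , a)) , 1st , 3rd
  ∞-joined 1F (a , 0F) = inj₂ (inj₁ (0F , a)) , 1st , 3rd
  ∞-joined 2F (a , 0F) = inj₂ (inj₁ (1F , a)) , 1st , 3rd
  ∞-joined i  (a , 1F) = inj₂ (inj₁ (i  , a)) , 1st , 2nd

  square : ∀ i x → Joined block (inj₂ (i , x)) (inj₂ (next i , x · x))
  square i (a , b) rewrite even-half-idempotent n-1 a b with b
  ... | 0F = inj₁ a , in-column i a , in-column (next i) a
  ... | 1F = inj₂ (inj₁ (i , a)) , 2nd , 3rd

  covers : Covers block
  covers ∞ ∞ ∞≢∞ = contradiction refl ∞≢∞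
  covers ∞ (inj₂ (i , x)) _ = ∞-joined i x
  covers (inj₂ (i , x)) ∞ _ = joined-sym {block = block} (∞-joined i x)
  covers (inj₂ u) (inj₂ v) =
    layers-cover {block = block} inj₂ (joined-inj₂ ∘ joined-inj₂ ∘ joined-map inj₂) square u v

  finite-covering : Covering (Fin (1 + 3 * (N * 2))) (Fin (N + (3 * N + 3 * tri (N * 2))))
  finite-covering = transport
    (⊎-↔-+ Fin↔ (×-↔-* Fin↔ (×-↔-* Fin↔ Fin↔)))
    (⊎-↔-+ Fin↔ (⊎-↔-+ (×-↔-* Fin↔ Fin↔) (×-↔-* Fin↔ Fin↔)))
    (block , covers)

-- Joins all pairs of points on 6n + 5 points except the pairs inside the five points
-- ∞₀, ∞₁ and (i , centre).
module Hole (n : ℕ) {X : Set} (∞ : Fin 2 → X) where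

  Q : Set
  Q = Fin 1 ⊎ Fin n × Fin 2

  Q↔Fin : Q ↔ Fin (1 + n * 2)
  Q↔Fin = ⊎-↔-+ Fin↔ (×-↔-* Fin↔ Fin↔)

  pattern centre = inj₁ 0F

  flip : Fin 2 → Fin 2
  flip 0F = 1F
  flip 1F = 0F

  -- Untwisted, the missing squares would form two triangles for each a, which have no perfect
  -- matching. Exchanging the two copies on the way from level 2 to level 0 joins them into a
  -- hexagon. The centre is fixed, so the three centres keep their triangle, which belongs to the
  -- hole.
  α : Q → Q
  α centre         = centre
  α (inj₂ (a , b)) = inj₂ (a , flip b)

  α-involutive : ∀ x → α (α x) ≡ x
  α-involutive centre          = refl
  α-involutive (inj₂ (a , 0F)) = refl
  α-involutive (inj₂ (a , 1F)) = refl

  open Inverse Q↔Fin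
  module O = Quasigroup (odd-quasigroup n)

  straight : Quasigroup Q
  straight = record
    { _·_   = λ x y → from (to x O.· to y)
    ; comm  = λ x y → cong from (O.comm (to x) (to y))
    ; solve = λ x z → let y , eq = O.solve (to x) (to z) in
        from y , trans (cong (λ i → from (to x O.· i)) (strictlyInverseˡ y)) (trans (cong from eq) (strictlyInverseʳ z))
    }

  twisted : Quasigroup Q
  twisted = record
    { _·_   = λ x y → α (x · y)
    ; comm  = λ x y → cong α (comm x y)
    ; solve = λ x z → let y , eq = solve x (α z) in y , trans (cong α eq) (α-involutive z)
    }
    where open Quasigroup straight

  quasi : Fin 3 → Quasigroup Q
  quasi 0F = straight
  quasi 1F = straight
  quasi 2F = twisted

  open Layers Q↔Fin quasi public

  idempotent : ∀ x → from (to x O.· to x) ≡ x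
  idempotent x = trans (cong from (odd-idempotent n (to x))) (strictlyInverseʳ x)

  -- A general X in place of the two infinite points lets `Six` adjoin a third one.
  Point : Set
  Point = X ⊎ Fin 3 × Q

  point : Fin 3 → Fin n → Fin 2 → Point
  point i a b = inj₂ (i , inj₂ (a , b))

  -- The pairs not joined by the layers form, for each a, a hexagon on the points (i , a , b); its
  -- edges are split into two perfect matchings, which are joined to ∞₀ and to ∞₁.
  hexagon : Fin 3 × Fin n × Fin 2 → Triple Point
  hexagon (0F , a , b) = inj₁ (∞ b) , point 0F a b        , point 1F a b
  hexagon (1F , a , b) = inj₁ (∞ b) , point 2F a b        , point 0F a (flip b)
  hexagon (2F , a , b) = inj₁ (∞ b) , point 1F a (flip b) , point 2F a (flip b)

  Index : Set
  Index = Fin 3 × Fin n × Fin 2 ⊎ Fin 3 × Fin (tri (1 + n * 2))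

  block : Index → Triple Point
  block = [ hexagon , map₃ inj₂ ∘ layer ]

  ∞-joined : ∀ c i a b → Joined block (inj₁ (∞ c)) (point i a b)
  ∞-joined 0F 0F a 0F = inj₁ (0F , a , 0F) , 1st , 2nd
  ∞-joined 0F 1F a 0F = inj₁ (0F , a , 0F) , 1st , 3rd
  ∞-joined 0F 2F a 0F = inj₁ (1F , a , 0F) , 1st , 2nd
  ∞-joined 0F 0F a 1F = inj₁ (1F , a , 0F) , 1st , 3rd
  ∞-joined 0F 1F a 1F = inj₁ (2F , a , 0F) , 1st , 2nd
  ∞-joined 0F 2F a 1F = inj₁ (2F , a , 0F) , 1st , 3rd
  ∞-joined 1F 0F a 1F = inj₁ (0F , a , 1F) , 1st , 2nd
  ∞-joined 1F 1F a 1F = inj₁ (0F , a , 1F) , 1st , 3rd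
  ∞-joined 1F 2F a 1F = inj₁ (1F , a , 1F) , 1st , 2nd
  ∞-joined 1F 0F a 0F = inj₁ (1F , a , 1F) , 1st , 3rd
  ∞-joined 1F 1F a 0F = inj₁ (2F , a , 1F) , 1st , 2nd
  ∞-joined 1F 2F a 0F = inj₁ (2F , a , 1F) , 1st , 3rd

  square : ∀ i a b → Joined block (point i a b) (inj₂ (next i , inj₂ (a , b) ·[ i ] inj₂ (a , b)))
  square 0F a b rewrite idempotent (inj₂ (a , b)) = inj₁ (0F , a , b) , 2nd , 3rd
  square 2F a b rewrite idempotent (inj₂ (a , b)) = inj₁ (1F , a , b) , 2nd , 3rd
  square 1F a b rewrite idempotent (inj₂ (a , b)) with b
  ... | 0F = inj₁ (2F , a , 1F) , 2nd , 3rd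
  ... | 1F = inj₁ (2F , a , 0F) , 2nd , 3rd

  square-centre : ∀ i → centre ·[ i ] centre ≡ centre
  square-centre 0F = idempotent centre
  square-centre 1F = idempotent centre
  square-centre 2F = cong α (idempotent centre)

  covers : ∀ {J : Set} {block′ : J → Triple Point} →
           (∀ {u v} → Joined block u v → Joined block′ u v) →
           (∀ i j → inj₂ (i , centre) ≢ inj₂ (j , centre) → Joined block′ (inj₂ (i , centre)) (inj₂ (j , centre))) →
           ∀ u v → inj₂ u ≢ inj₂ v → Joined block′ (inj₂ u) (inj₂ v)
  covers {block′ = block′} lift centres = layers-cover {block = block′} inj₂ (lift ∘ joined-inj₂ ∘ joined-map inj₂) square′
    where
    next≢ : ∀ i → next i ≢ i
    next≢ 0F ()
    next≢ 1F ()
    next≢ 2F ()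
    square′ : ∀ i x → Joined block′ (inj₂ (i , x)) (inj₂ (next i , x ·[ i ] x))
    square′ i (inj₂ (a , b)) = lift (square i a b)
    square′ i centre rewrite square-centre i = centres i (next i) λ { eq → next≢ i (sym (cong level eq)) }
      where
      level : Point → Fin 3
      level (inj₁ _)       = i
      level (inj₂ (j , _)) = j

-- Filling a hole of five or six points

joined? : ∀ {k m} (block : Fin k → Triple (Fin m)) u v → Dec (Joined block u v)
joined? block u v = Fin.any? λ i → u ∈₃? block i ×-dec v ∈₃? block i
  where
  _∈₃?_ : ∀ u t → Dec (u ∈₃ t)
  u ∈₃? (x , y , z) = (u Fin.≟ x) ⊎-dec (u Fin.≟ y) ⊎-dec (u Fin.≟ z)

covers? : ∀ {k m} (block : Fin k → Triple (Fin m)) → Dec (Covers block)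
covers? block = Fin.all? λ u → Fin.all? λ v → ¬? (u Fin.≟ v) →-dec joined? block u v

-- The pair 3, 4 lies in three triples. This surplus of two is the only repetition in the coverings
-- of `Five`.
K₅ : Covering (Fin 5) (Fin 4)
K₅ = block , from-yes (covers? block)
  where
  block : Fin 4 → Triple (Fin 5)
  block 0F = 0F , 1F , 2F
  block 1F = 0F , 3F , 4F
  block 2F = 1F , 3F , 4F
  block 3F = 2F , 3F , 4F

K₆ : Covering (Fin 6) (Fin 6)
K₆ = block , from-yes (covers? block)
  where
  block : Fin 6 → Triple (Fin 6)
  block 0F = 0F , 1F , 2F
  block 1F = 0F , 1F , 3F
  block 2F = 0F , 4F , 5F
  block 3F = 1F , 4F , 5F
  block 4F = 2F , 3F , 4F
  block 5F = 2F , 3F , 5F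

module Five (n : ℕ) where

  open Hole n {Fin 2} id renaming (block to hole-block; covers to hole-covers)

  ι : Fin 2 ⊎ Fin 3 → Point
  ι (inj₁ c) = inj₁ c
  ι (inj₂ i) = inj₂ (i , centre)

  small : Covering (Fin 2 ⊎ Fin 3) (Fin 4)
  small = transport Fin.+↔⊎ Fin↔ K₅

  block : Index ⊎ Fin 4 → Triple Point
  block = [ hole-block , map₃ ι ∘ proj₁ small ]

  in-hole : ∀ s t → ι s ≢ ι t → Joined block (ι s) (ι t)
  in-hole s t s≢t = joined-inj₂ (joined-map ι (proj₂ small s t (s≢t ∘ cong ι)))

  ∞-any : ∀ c i x → Joined block (inj₁ c) (inj₂ (i , x))
  ∞-any c i centre         = in-hole (inj₁ c) (inj₂ i) λ ()
  ∞-any c i (inj₂ (a , b)) = joined-inj₁ (∞-joined c i a b)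

  covers : Covers block
  covers (inj₁ c) (inj₁ d) = in-hole (inj₁ c) (inj₁ d)
  covers (inj₁ c) (inj₂ (i , x)) _ = ∞-any c i x
  covers (inj₂ (i , x)) (inj₁ c) _ = joined-sym {block = block} (∞-any c i x)
  covers (inj₂ u) (inj₂ v) = hole-covers joined-inj₁ (λ i j → in-hole (inj₂ i) (inj₂ j)) u v

  finite-covering : Covering (Fin (2 + 3 * (1 + n * 2))) (Fin (3 * (n * 2) + 3 * tri (1 + n * 2) + 4))
  finite-covering = transport
    (⊎-↔-+ Fin↔ (×-↔-* Fin↔ Q↔Fin))
    (⊎-↔-+ (⊎-↔-+ (×-↔-* Fin↔ (×-↔-* Fin↔ Fin↔)) (×-↔-* Fin↔ Fin↔)) Fin↔)
    (block , covers)

module Six (n : ℕ) where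

  open Hole n {Fin 3} inject₁ renaming (block to hole-block; covers to hole-covers)

  ι : Fin 3 ⊎ Fin 3 → Point
  ι (inj₁ c) = inj₁ c
  ι (inj₂ i) = inj₂ (i , centre)

  small : Covering (Fin 3 ⊎ Fin 3) (Fin 6)
  small = transport Fin.+↔⊎ Fin↔ K₆

  -- The third infinite point has to meet 6n points outside the hole. Pairing each point with its
  -- flipped copy does this with 3n triples, although those pairs are already joined by the layers.
  rung : Fin 3 × Fin n → Triple Point
  rung (i , a) = inj₁ 2F , point i a 0F , point i a 1F

  block : (Index ⊎ Fin 6) ⊎ Fin 3 × Fin n → Triple Point
  block = [ [ hole-block , map₃ ι ∘ proj₁ small ] , rung ]

  in-hole : ∀ s t → ι s ≢ ι t → Joined block (ι s) (ι t)
  in-hole s t s≢t = joined-inj₁ (joined-inj₂ (joined-map ι (proj₂ small s t (s≢t ∘ cong ι))))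

  ∞-any : ∀ c i x → Joined block (inj₁ c) (inj₂ (i , x))
  ∞-any c  i centre          = in-hole (inj₁ c) (inj₂ i) λ ()
  ∞-any 0F i (inj₂ (a , b))  = joined-inj₁ (joined-inj₁ (∞-joined 0F i a b))
  ∞-any 1F i (inj₂ (a , b))  = joined-inj₁ (joined-inj₁ (∞-joined 1F i a b))
  ∞-any 2F i (inj₂ (a , 0F)) = inj₂ (i , a) , 1st , 2nd
  ∞-any 2F i (inj₂ (a , 1F)) = inj₂ (i , a) , 1st , 3rd

  covers : Covers block
  covers (inj₁ c) (inj₁ d) = in-hole (inj₁ c) (inj₁ d)
  covers (inj₁ c) (inj₂ (i , x)) _ = ∞-any c i x
  covers (inj₂ (i , x)) (inj₁ c) _ = joined-sym {block = block} (∞-any c i x)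
  covers (inj₂ u) (inj₂ v) = hole-covers (joined-inj₁ ∘ joined-inj₁) (λ i j → in-hole (inj₂ i) (inj₂ j)) u v

  finite-covering : Covering (Fin (3 + 3 * (1 + n * 2))) (Fin (3 * (n * 2) + 3 * tri (1 + n * 2) + 6 + 3 * n))
  finite-covering = transport
    (⊎-↔-+ Fin↔ (×-↔-* Fin↔ Q↔Fin))
    (⊎-↔-+ (⊎-↔-+ (⊎-↔-+ (×-↔-* Fin↔ (×-↔-* Fin↔ Fin↔)) (×-↔-* Fin↔ Fin↔)) Fin↔) (×-↔-* Fin↔ Fin↔))
    (block , covers)

-- The new point is joined to the old ones two at a time. Their number is odd, so one of them is
-- left over and gets a degenerate triple.
add-point : ∀ {h c} → Covering (Fin (1 + h * 2)) (Fin c) → Covering (Fin (2 + h * 2)) (Fin (c + (1 + h)))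
add-point {h} {c} odd = transport (⊎-↔-+ Fin↔ Fin↔) (⊎-↔-+ Fin↔ (⊎-↔-+ Fin↔ Fin↔)) (block , covers)
  where
  Odd Point : Set
  Odd = Fin 1 ⊎ Fin h × Fin 2
  Point = Fin 1 ⊎ Fin (1 + h * 2)
  Odd↔ : Odd ↔ Fin (1 + h * 2)
  Odd↔ = ⊎-↔-+ Fin↔ (×-↔-* Fin↔ Fin↔)
  open Inverse Odd↔
  new : Fin 1 ⊎ Fin h → Triple Point
  new (inj₁ _) = inj₁ 0F , inj₂ 0F , inj₂ 0F
  new (inj₂ a) = inj₁ 0F , inj₂ (to (inj₂ (a , 0F))) , inj₂ (to (inj₂ (a , 1F)))
  block : Fin c ⊎ Fin 1 ⊎ Fin h → Triple Point
  block = [ map₃ inj₂ ∘ proj₁ odd , new ]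
  new-joined : ∀ x → Joined block (inj₁ 0F) (inj₂ (to x))
  new-joined (inj₁ 0F)       = inj₂ (inj₁ 0F) , 1st , 2nd
  new-joined (inj₂ (a , 0F)) = inj₂ (inj₂ a) , 1st , 2nd
  new-joined (inj₂ (a , 1F)) = inj₂ (inj₂ a) , 1st , 3rd
  new-joined′ : ∀ u → Joined block (inj₁ 0F) (inj₂ u)
  new-joined′ u = subst (λ v → Joined block (inj₁ 0F) (inj₂ v)) (strictlyInverseˡ u) (new-joined (from u))
  covers : Covers block
  covers (inj₁ 0F) (inj₁ 0F) u≢v = contradiction refl u≢v
  covers (inj₁ 0F) (inj₂ v)  _   = new-joined′ v
  covers (inj₂ u)  (inj₁ 0F) _   = joined-sym {block = block} (new-joined′ u)
  covers (inj₂ u)  (inj₂ v)  u≢v = joined-inj₁ (joined-map inj₂ (proj₂ odd u v (u≢v ∘ cong inj₂)))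

resize : ∀ {m m′ c c′} → m ≡ m′ → c ≡ c′ → Covering (Fin m) (Fin c) → Covering (Fin m′) (Fin c′)
resize refl refl covering = covering

-- Covering sizes by residue modulo 6

covering-6n+3 : ∀ n → Covering (Fin (3 + n * 6)) (Fin ((1 + 2 * n) * (1 + 3 * n)))
covering-6n+3 n = resize (size n) (trans (cong (λ i → 1 + n * 2 + 3 * i) (tri-odd n)) (count n)) (Bose.finite-covering n)
  where
  size : ∀ n → 3 * (1 + n * 2) ≡ 3 + n * 6
  size = solve-∀
  count : ∀ n → 1 + n * 2 + 3 * (n * (1 + n * 2)) ≡ (1 + 2 * n) * (1 + 3 * n)
  count = solve-∀

covering-6n+4 : ∀ n → Covering (Fin (4 + n * 6)) (Fin ((1 + 2 * n) * (1 + 3 * n) + (2 + 3 * n)))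
covering-6n+4 n = resize (size₂ n) (count n) (add-point (resize (size₁ n) refl (covering-6n+3 n)))
  where
  size₁ : ∀ n → 3 + n * 6 ≡ 1 + (1 + 3 * n) * 2
  size₁ = solve-∀
  size₂ : ∀ n → 2 + (1 + 3 * n) * 2 ≡ 4 + n * 6
  size₂ = solve-∀
  count : ∀ n → (1 + 2 * n) * (1 + 3 * n) + (1 + (1 + 3 * n)) ≡ (1 + 2 * n) * (1 + 3 * n) + (2 + 3 * n)
  count = solve-∀

covering-6n+5 : ∀ n → Covering (Fin (5 + n * 6)) (Fin (6 * n * n + 9 * n + 4))
covering-6n+5 n = resize (size n) (trans (cong (λ i → 3 * (n * 2) + 3 * i + 4) (tri-odd n)) (count n)) (Five.finite-covering n)
  where
  size : ∀ n → 2 + 3 * (1 + n * 2) ≡ 5 + n * 6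
  size = solve-∀
  count : ∀ n → 3 * (n * 2) + 3 * (n * (1 + n * 2)) + 4 ≡ 6 * n * n + 9 * n + 4
  count = solve-∀

covering-6n+6 : ∀ n → Covering (Fin (6 + n * 6)) (Fin (6 * (1 + n) * (1 + n)))
covering-6n+6 n = resize (size n) (trans (cong (λ i → 3 * (n * 2) + 3 * i + 6 + 3 * n) (tri-odd n)) (count n)) (Six.finite-covering n)
  where
  size : ∀ n → 3 + 3 * (1 + n * 2) ≡ 6 + n * 6
  size = solve-∀
  count : ∀ n → 3 * (n * 2) + 3 * (n * (1 + n * 2)) + 6 + 3 * n ≡ 6 * (1 + n) * (1 + n)
  count = solve-∀

covering-6n+7 : ∀ n → Covering (Fin (7 + n * 6)) (Fin ((1 + n) * (7 + 6 * n)))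
covering-6n+7 n = resize (size n)
  (trans (cong (λ i → 1 + n + (3 * (1 + n) + 3 * (1 + n * 2 + i))) (tri-odd n)) (count n)) (Skolem.finite-covering n)
  where
  size : ∀ n → 1 + 3 * ((1 + n) * 2) ≡ 7 + n * 6
  size = solve-∀
  count : ∀ n → 1 + n + (3 * (1 + n) + 3 * (1 + n * 2 + n * (1 + n * 2))) ≡ (1 + n) * (7 + 6 * n)
  count = solve-∀

covering-6n+8 : ∀ n → Covering (Fin (8 + n * 6)) (Fin ((1 + n) * (7 + 6 * n) + (4 + 3 * n)))
covering-6n+8 n = resize (size₂ n) (count n) (add-point (resize (size₁ n) refl (covering-6n+7 n)))
  where
  size₁ : ∀ n → 7 + n * 6 ≡ 1 + (3 + 3 * n) * 2
  size₁ = solve-∀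
  size₂ : ∀ n → 2 + (3 + 3 * n) * 2 ≡ 8 + n * 6
  size₂ = solve-∀
  count : ∀ n → (1 + n) * (7 + 6 * n) + (1 + (3 + 3 * n)) ≡ (1 + n) * (7 + 6 * n) + (4 + 3 * n)
  count = solve-∀

-- 6 (c₁ + c₂) exceeds the lower bound k (2k + 1) by less than 6, except for k ≡ 4 (mod 6), where the
-- lower bound is not attained.
record NearOptimal (k c₁ c₂ : ℕ) : Set where
  field
    cover₁ : Covering (Fin k) (Fin c₁)
    cover₂ : Covering (Fin (suc k)) (Fin c₂)
    excess : ℕ
    total  : 6 * (c₁ + c₂) ≡ suc (2 * k) * k + excess
    small  : excess ≤ 5 ⊎ (excess ≤ 6 × ¬ 6 ∣ suc k * k)

near-optimal : ∀ k → 3 ≤ k → ∃[ c₁ ] ∃[ c₂ ] NearOptimal k c₁ c₂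
near-optimal (suc zero) (s≤s ())
near-optimal (suc (suc zero)) (s≤s (s≤s ()))
near-optimal (suc (suc (suc j))) _ with j divMod 6
near-optimal (suc (suc (suc j))) _ | result n 0F refl = _ , _ , record
  { cover₁ = covering-6n+3 n ; cover₂ = covering-6n+4 n ; excess = 3 ; total = total n ; small = inj₁ (from-yes (3 ≤? 5)) }
  where
  total : ∀ n → 6 * ((1 + 2 * n) * (1 + 3 * n) + ((1 + 2 * n) * (1 + 3 * n) + (2 + 3 * n))) ≡ suc (2 * (3 + n * 6)) * (3 + n * 6) + 3
  total = solve-∀
near-optimal (suc (suc (suc j))) _ | result n 1F refl = _ , _ , record
  { cover₁ = covering-6n+4 n ; cover₂ = covering-6n+5 n ; excess = 6 ; total = total n
  -- Here k = 6n + 4, so k(k + 1) leaves remainder 2 modulo 6.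
  ; small = inj₂ (≤-refl , λ d → >⇒∤ (s≤s (s≤s (s≤s z≤n)))
      (∣m+n∣m⇒∣n (subst (6 ∣_) (lem n) d) (m∣m*n (6 * n * n + 9 * n + 3)))) }
  where
  total : ∀ n → 6 * ((1 + 2 * n) * (1 + 3 * n) + (2 + 3 * n) + (6 * n * n + 9 * n + 4)) ≡ suc (2 * (4 + n * 6)) * (4 + n * 6) + 6
  total = solve-∀
  lem : ∀ n → suc (4 + n * 6) * (4 + n * 6) ≡ 6 * (6 * n * n + 9 * n + 3) + 2
  lem = solve-∀
near-optimal (suc (suc (suc j))) _ | result n 2F refl = _ , _ , record
  { cover₁ = covering-6n+5 n ; cover₂ = covering-6n+6 n ; excess = 5 ; total = total n ; small = inj₁ ≤-refl }
  where
  total : ∀ n → 6 * ((6 * n * n + 9 * n + 4) + 6 * (1 + n) * (1 + n)) ≡ suc (2 * (5 + n * 6)) * (5 + n * 6) + 5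
  total = solve-∀
near-optimal (suc (suc (suc j))) _ | result n 3F refl = _ , _ , record
  { cover₁ = covering-6n+6 n ; cover₂ = covering-6n+7 n ; excess = 0 ; total = total n ; small = inj₁ z≤n }
  where
  total : ∀ n → 6 * (6 * (1 + n) * (1 + n) + (1 + n) * (7 + 6 * n)) ≡ suc (2 * (6 + n * 6)) * (6 + n * 6) + 0
  total = solve-∀
near-optimal (suc (suc (suc j))) _ | result n 4F refl = _ , _ , record
  { cover₁ = covering-6n+7 n ; cover₂ = covering-6n+8 n ; excess = 3 ; total = total n ; small = inj₁ (from-yes (3 ≤? 5)) }
  where
  total : ∀ n → 6 * ((1 + n) * (7 + 6 * n) + ((1 + n) * (7 + 6 * n) + (4 + 3 * n))) ≡ suc (2 * (7 + n * 6)) * (7 + n * 6) + 3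
  total = solve-∀
near-optimal (suc (suc (suc j))) _ | result n 5F refl = _ , _ , record
  { cover₁ = covering-6n+8 n ; cover₂ = covering-6n+3 (suc n) ; excess = 2 ; total = total n ; small = inj₁ (from-yes (2 ≤? 5)) }
  where
  total : ∀ n → 6 * ((1 + n) * (7 + 6 * n) + (4 + 3 * n) + (1 + 2 * suc n) * (1 + 3 * suc n)) ≡ suc (2 * (8 + n * 6)) * (8 + n * 6) + 2
  total = solve-∀

-- Dominating families and triangle coverings

∣insert∣ : (p : Subset n) (x : Fin n) → lookup p x ≡ false → ∣ p [ x ]≔ true ∣ ≡ suc ∣ p ∣
∣insert∣ (false ∷ p) zero    _   = refl
∣insert∣ (true ∷ p)  (suc x) x∉p = cong suc (∣insert∣ p x x∉p)
∣insert∣ (false ∷ p) (suc x) x∉p = ∣insert∣ p x x∉p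

∣remove∣ : (p : Subset n) (x : Fin n) → lookup p x ≡ true → ∣ p ∣ ≡ suc ∣ p [ x ]≔ false ∣
∣remove∣ (true ∷ p)  zero    _   = refl
∣remove∣ (true ∷ p)  (suc x) x∈p = cong suc (∣remove∣ p x x∈p)
∣remove∣ (false ∷ p) (suc x) x∈p = ∣remove∣ p x x∈p

∣insert∩∣ : (p q : Subset n) (x : Fin n) → ∣ (p [ x ]≔ true) ∩ q ∣ ≤ χ (lookup q x) + ∣ p ∩ q ∣
∣insert∩∣ (true ∷ p)  (true ∷ q)  zero = n≤1+n _
∣insert∩∣ (true ∷ p)  (false ∷ q) zero = ≤-refl
∣insert∩∣ (false ∷ p) (true ∷ q)  zero = ≤-refl
∣insert∩∣ (false ∷ p) (false ∷ q) zero = ≤-refl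
∣insert∩∣ (true ∷ p)  (true ∷ q)  (suc x) = ≤-trans (s≤s (∣insert∩∣ p q x)) (≤-reflexive (sym (+-suc (χ (lookup q x)) _)))
∣insert∩∣ (true ∷ p)  (false ∷ q) (suc x) = ∣insert∩∣ p q x
∣insert∩∣ (false ∷ p) (_ ∷ q)     (suc x) = ∣insert∩∣ p q x

some-member : (p : Subset n) → ∣ p ∣ ≡ suc k → ∃[ x ] lookup p x ≡ true
some-member (true ∷ p)  _ = zero , refl
some-member (false ∷ p) e with some-member p e
... | x , x∈p = suc x , x∈p

∈-remove⁻ : (p : Subset n) (x : Fin n) {y : Fin n} → lookup (p [ x ]≔ false) y ≡ true → x ≢ y × lookup p y ≡ true
∈-remove⁻ p x {y} y∈ with x Fin.≟ y
... | yes refl = contradiction (trans (sym (Vec.lookup∘update x p false)) y∈) λ ()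
... | no x≢y   = x≢y , trans (sym (Vec.lookup∘update′ (x≢y ∘ sym) p false)) y∈

three-members : (p : Subset n) → ∣ p ∣ ≡ 3 → ∃[ x ] ∃[ y ] ∃[ z ]
  (x ≢ y × y ≢ z × x ≢ z × lookup p x ≡ true × lookup p y ≡ true × lookup p z ≡ true)
three-members p ∣p∣≡3 with some-member p ∣p∣≡3
... | x , x∈p with some-member (p [ x ]≔ false) (suc-injective (trans (sym (∣remove∣ p x x∈p)) ∣p∣≡3))
...   | y , y∈p′ with some-member (p [ x ]≔ false [ y ]≔ false)
          (suc-injective (trans (sym (∣remove∣ (p [ x ]≔ false) y y∈p′))
            (suc-injective (trans (sym (∣remove∣ p x x∈p)) ∣p∣≡3))))
...     | z , z∈p″ with ∈-remove⁻ p x y∈p′ | ∈-remove⁻ (p [ x ]≔ false) y z∈p″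
...       | x≢y , y∈p | y≢z , z∈p′ with ∈-remove⁻ p x z∈p′
...         | x≢z , z∈p = x , y , z , x≢y , y≢z , x≢z , x∈p , y∈p , z∈p

2≤∣p∣ : (p : Subset n) {x y : Fin n} → x ≢ y → lookup p x ≡ true → lookup p y ≡ true → 2 ≤ ∣ p ∣
2≤∣p∣ p {x} {y} x≢y x∈p y∈p = ≤-trans
  (s≤s (≤-trans (s≤s z≤n) (≤-reflexive (sym (∣remove∣ (p [ x ]≔ false) y (trans (Vec.lookup∘update′ (x≢y ∘ sym) p false) y∈p))))))
  (≤-reflexive (sym (∣remove∣ p x x∈p)))

∩-full⇒≡ : (p q : Subset n) → ∣ p ∣ ≤ ∣ p ∩ q ∣ → ∣ q ∣ ≤ ∣ p ∩ q ∣ → p ≡ q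
∩-full⇒≡ []          []          _  _  = refl
∩-full⇒≡ (true ∷ p)  (true ∷ q)  p≤ q≤ = cong (true ∷_) (∩-full⇒≡ p q (s≤s⁻¹ p≤) (s≤s⁻¹ q≤))
∩-full⇒≡ (true ∷ p)  (false ∷ q) p≤ q≤ = contradiction (≤-trans p≤ (∣p∩q∣≤∣p∣ p q)) 1+n≰n
∩-full⇒≡ (false ∷ p) (true ∷ q)  p≤ q≤ = contradiction (≤-trans q≤ (∣p∩q∣≤∣q∣ p q)) 1+n≰n
∩-full⇒≡ (false ∷ p) (false ∷ q) p≤ q≤ = cong (false ∷_) (∩-full⇒≡ p q p≤ q≤)

KSubset-≡ : {p q : KSubset n k} → proj₁ p ≡ proj₁ q → p ≡ q
KSubset-≡ {p = p , e} {q = .p , e′} refl = cong (p ,_) (≡-irrelevant e e′)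

_≟ᴷ_ : DecidableEquality (KSubset n k)
_≟ᴷ_ = Product.≡-dec (Vec.≡-dec _≟ᵇ_) (λ _ _ → yes (≡-irrelevant _ _))

module _ {x y z : Fin n} (x≢y : x ≢ y) (y≢z : y ≢ z) (x≢z : x ≢ z) where

  private
    p₁ p₂ p₃ : Subset n
    p₁ = ∅ [ z ]≔ true
    p₂ = p₁ [ y ]≔ true
    p₃ = p₂ [ x ]≔ true

    y∉p₁ : lookup p₁ y ≡ false
    y∉p₁ = trans (Vec.lookup∘update′ y≢z ∅ true) (Vec.lookup-replicate y false)

    x∉p₂ : lookup p₂ x ≡ false
    x∉p₂ = trans (Vec.lookup∘update′ x≢y p₁ true)
             (trans (Vec.lookup∘update′ x≢z ∅ true) (Vec.lookup-replicate x false))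

  three-set : KSubset n 3
  three-set = p₃ , trans (∣insert∣ p₂ x x∉p₂) (cong suc (trans (∣insert∣ p₁ y y∉p₁)
    (cong suc (trans (∣insert∣ ∅ z (Vec.lookup-replicate z false)) (cong suc (∣⊥∣≡0 n))))))

  three-set-∋ : ∀ {v} → v ≡ x ⊎ v ≡ y ⊎ v ≡ z → member three-set v ≡ true
  three-set-∋ (inj₁ refl)        = Vec.lookup∘update x p₂ true
  three-set-∋ (inj₂ (inj₁ refl)) = trans (Vec.lookup∘update′ (x≢y ∘ sym) p₂ true) (Vec.lookup∘update y p₁ true)
  three-set-∋ (inj₂ (inj₂ refl)) = trans (Vec.lookup∘update′ (x≢z ∘ sym) p₂ true)
    (trans (Vec.lookup∘update′ (y≢z ∘ sym) p₁ true) (Vec.lookup∘update z ∅ true))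

  ∣three-set∩∣ : ∀ q → ∣ p₃ ∩ q ∣ ≤ χ (lookup q x) + (χ (lookup q y) + (χ (lookup q z) + 0))
  ∣three-set∩∣ q = ≤-trans (∣insert∩∣ p₂ q x) (+-monoʳ-≤ (χ (lookup q x))
    (≤-trans (∣insert∩∣ p₁ q y) (+-monoʳ-≤ (χ (lookup q y))
    (≤-trans (∣insert∩∣ ∅ q z) (+-monoʳ-≤ (χ (lookup q z))
    (≤-reflexive (trans (cong ∣_∣ (∩-zeroˡ q)) (∣⊥∣≡0 n))))))))

Linked : List (KSubset n 3) → Fin n → Fin n → Set
Linked D u v = ∃[ q ] (q ∈ D × member q u ≡ true × member q v ≡ true)

LinksTriples : List (KSubset n 3) → Set
LinksTriples D = ∀ {x y z} → x ≢ y → y ≢ z → x ≢ z → Linked D x y ⊎ Linked D y z ⊎ Linked D x z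

-- A triple of D equal or adjacent to {x, y, z} contains at least two of these three points.
dominating⇒links : {D : List (KSubset n 3)} → IsDominating (Johnson n 3) D → LinksTriples D
dominating⇒links {n} {D} dom {x} {y} {z} x≢y y≢z x≢z with dom (three-set x≢y y≢z x≢z)
... | inj₁ ∈D = inj₁ (_ , ∈D , three-set-∋ x≢y y≢z x≢z (inj₁ refl) , three-set-∋ x≢y y≢z x≢z (inj₂ (inj₁ refl)))
... | inj₂ (q , q∈D , adj) = two (member q x) (member q y) (member q z) refl refl refl
      (≤-trans (≤-reflexive (suc-injective (sym adj))) (∣three-set∩∣ x≢y y≢z x≢z (proj₁ q)))
  where
  two : ∀ a b c → member q x ≡ a → member q y ≡ b → member q z ≡ c → 2 ≤ χ a + (χ b + (χ c + 0)) →
        Linked D x y ⊎ Linked D y z ⊎ Linked D x z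
  two true  true  _     qx qy qz _ = inj₁ (q , q∈D , qx , qy)
  two false true  true  qx qy qz _ = inj₂ (inj₁ (q , q∈D , qy , qz))
  two true  false true  qx qy qz _ = inj₂ (inj₂ (q , q∈D , qx , qz))
  two true  false false qx qy qz (s≤s ())
  two false true  false qx qy qz (s≤s ())
  two false false true  qx qy qz (s≤s ())

-- A triple q of D through a linked pair of p meets p in two points, hence is adjacent to p, or in
-- three, hence equals p.
links⇒dominating : {D : List (KSubset n 3)} → LinksTriples D → IsDominating (Johnson n 3) D
links⇒dominating {n} {D} links (p , ∣p∣≡3) with three-members p ∣p∣≡3
... | x , y , z , x≢y , y≢z , x≢z , x∈p , y∈p , z∈p =
      [ meets x≢y x∈p y∈p , [ meets y≢z y∈p z∈p , meets x≢z x∈p z∈p ] ] (links x≢y y≢z x≢z)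
  where
  meets : ∀ {u v} → u ≢ v → lookup p u ≡ true → lookup p v ≡ true → Linked D u v →
          (p , ∣p∣≡3) ∈ D ⊎ (∃[ q ] (q ∈ D × suc ∣ p ∩ proj₁ q ∣ ≡ 3))
  meets {u} {v} u≢v u∈p v∈p ((q , ∣q∣≡3) , q∈D , u∈q , v∈q)
    with m≤n⇒m<n∨m≡n (≤-trans (∣p∩q∣≤∣p∣ p q) (≤-reflexive ∣p∣≡3))
  ... | inj₁ ∣p∩q∣<3 = inj₂ (_ , q∈D , cong suc (≤-antisym (s≤s⁻¹ ∣p∩q∣<3)
      (2≤∣p∣ (p ∩ q) u≢v (both u∈p u∈q) (both v∈p v∈q))))
    where
    both : ∀ {w} → lookup p w ≡ true → lookup q w ≡ true → lookup (p ∩ q) w ≡ true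
    both {w} w∈p w∈q = trans (Vec.lookup-zipWith _∧_ w p q) (cong₂ _∧_ w∈p w∈q)
  ... | inj₂ ∣p∩q∣≡3 = inj₁ (subst (_∈ D) (KSubset-≡ (sym (∩-full⇒≡ p q
          (≤-reflexive (trans ∣p∣≡3 (sym ∣p∩q∣≡3))) (≤-reflexive (trans ∣q∣≡3 (sym ∣p∩q∣≡3)))))) q∈D)

links⇒no-uncovered : {D : List (KSubset n 3)} → LinksTriples D → NoUncoveredTriangle D
links⇒no-uncovered {D = D} links x≢y y≢z x≢z xy yz xz =
  [ absurd xy , [ absurd yz , absurd xz ] ] (links x≢y y≢z x≢z)
  where
  absurd : ∀ {u v} → codegree D u v ≡ 0 → Linked D u v → ⊥
  absurd {u} {v} c≡0 (q , q∈D , qu , qv) = 1+n≰n (begin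
    1                               ≡⟨ cong₂ (λ i j → χ i * χ j) qu qv ⟨
    χ (member q u) * χ (member q v) ≤⟨ ∑ˡ-member (λ q → χ (member q u) * χ (member q v)) q∈D ⟩
    codegree D u v                  ≡⟨ c≡0 ⟩
    0                               ∎)
    where open ≤-Reasoning

deduplicate-distinct : {R : A → A → Set} (R? : Decidable R) (xs : List A) →
                       AllPairs (λ x y → ¬ R x y) (deduplicate R? xs)
deduplicate-distinct R? []       = []
deduplicate-distinct R? (x ∷ xs) =
  all-filter (¬? ∘ R? x) (deduplicate R? xs) ∷ AllPairs.filter⁺ (¬? ∘ R? x) (deduplicate-distinct R? xs)

_∈△?_ : (v : Fin m) (t : Triangle (K m)) → Dec (v ∈△ t)
v ∈△? t = (v Fin.≟ a) ⊎-dec (v Fin.≟ b) ⊎-dec (v Fin.≟ c)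
  where open Triangle t

_≈△?_ : Decidable (_≈△_ {K m})
s ≈△? t = Fin.all? λ v → map′ (λ (f , g) → mk⇔ f g) (λ e → Equivalence.to e , Equivalence.from e)
  (((v ∈△? s) →-dec (v ∈△? t)) ×-dec ((v ∈△? t) →-dec (v ∈△? s)))

distinct-triangles : (T : List (Triangle (K m))) → CoversEdges {K m} T →
  ∃[ T′ ] (IsTriangleSet {K m} T′ × CoversEdges {K m} T′ × length T′ ≤ length T)
distinct-triangles T covers =
  deduplicate _≈△?_ T , deduplicate-distinct _≈△?_ T ,
  (λ u v u≢v → Any.deduplicate⁺ _≈△?_
    (λ t≈s (u∈ , v∈) → Equivalence.from (t≈s u) u∈ , Equivalence.from (t≈s v) v∈) (covers u v u≢v)) ,
  length-deduplicate _≈△?_ T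

module _ {j : ℕ} where

  private
    m′ : ℕ
    m′ = 3 + j

  third : (x y : Fin m′) → x ≢ y → ∃[ z ] (z ≢ x × z ≢ y)
  third x y x≢y = punchIn x (punchIn y′ zero) , Fin.punchInᵢ≢i x _ ,
    λ eq → Fin.punchInᵢ≢i y′ zero (Fin.punchIn-injective x _ _ (trans eq (sym (Fin.punchIn-punchOut x≢y))))
    where y′ = punchOut x≢y

  edge-triangle : (x y : Fin m′) → x ≢ y → ∃[ t ] (_∈△_ {K m′} x t × y ∈△ t)
  edge-triangle x y x≢y with third x y x≢y
  ... | z , z≢x , z≢y = record { a = x ; b = y ; c = z ; a~b = x≢y ; b~c = z≢y ∘ sym ; a~c = z≢x ∘ sym } ,
      inj₁ refl , inj₂ (inj₁ refl)

  pair-triangle : (x y : Fin m′) → ∃[ t ] (_∈△_ {K m′} x t × y ∈△ t)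
  pair-triangle x y with x Fin.≟ y
  ... | no x≢y   = edge-triangle x y x≢y
  ... | yes refl with edge-triangle x (punchIn x zero) (Fin.punchInᵢ≢i x zero ∘ sym)
  ...   | t , x∈ , _ = t , x∈ , x∈

  triangle-⊇ : (t : Triple (Fin m′)) → ∃[ t′ ] (∀ {v} → v ∈₃ t → _∈△_ {K m′} v t′)
  triangle-⊇ (x , y , z) with x Fin.≟ y | y Fin.≟ z | x Fin.≟ z
  ... | yes refl | _ | _ with pair-triangle x z
  ...   | t , x∈ , z∈ = t , λ { 1st → x∈ ; 2nd → x∈ ; 3rd → z∈ }
  triangle-⊇ (x , y , z) | _ | yes refl | _ with pair-triangle x y
  ...   | t , x∈ , y∈ = t , λ { 1st → x∈ ; 2nd → y∈ ; 3rd → y∈ }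
  triangle-⊇ (x , y , z) | _ | _ | yes refl with pair-triangle x y
  ...   | t , x∈ , y∈ = t , λ { 1st → x∈ ; 2nd → y∈ ; 3rd → x∈ }
  triangle-⊇ (x , y , z) | no x≢y | no y≢z | no x≢z =
    record { a = x ; b = y ; c = z ; a~b = x≢y ; b~c = y≢z ; a~c = x≢z } , id

triangle-cover : ∀ {m c} → 3 ≤ m → Covering (Fin m) (Fin c) →
  ∃[ T ] (IsTriangleSet {K m} T × CoversEdges {K m} T × length T ≤ c)
triangle-cover {suc (suc (suc j))} {c} (s≤s (s≤s (s≤s z≤n))) (block , covers)
  with distinct-triangles T cover
  where
  T : List (Triangle (K (3 + j)))
  T = tabulate (λ i → proj₁ (triangle-⊇ (block i)))
  cover : CoversEdges {K (3 + j)} T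
  cover u v u≢v with covers u v u≢v
  ... | i , u∈ , v∈ = Any.tabulate⁺ i (proj₂ (triangle-⊇ (block i)) u∈ , proj₂ (triangle-⊇ (block i)) v∈)
... | T′ , distinct , cover′ , le = T′ , distinct , cover′ , ≤-trans le (≤-reflexive (length-tabulate _))

module _ {m₁ m₂ : ℕ} where

  private
    embed : {m : ℕ} (f : Fin m → Fin (m₁ + m₂)) → (∀ {x y} → f x ≡ f y → x ≡ y) → Triangle (K m) → KSubset (m₁ + m₂) 3
    embed f f-inj t = three-set (a~b ∘ f-inj) (b~c ∘ f-inj) (a~c ∘ f-inj)
      where open Triangle t

    embed-∋ : {m : ℕ} (f : Fin m → Fin (m₁ + m₂)) (f-inj : ∀ {x y} → f x ≡ f y → x ≡ y) (t : Triangle (K m)) →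
              ∀ {v} → v ∈△ t → member (embed f f-inj t) (f v) ≡ true
    embed-∋ f f-inj t v∈ = three-set-∋ (a~b ∘ f-inj) (b~c ∘ f-inj) (a~c ∘ f-inj)
      (Sum.map (cong f) (Sum.map (cong f) (cong f)) v∈)
      where open Triangle t

    side : (x : Fin (m₁ + m₂)) → (∃[ a ] x ≡ a ↑ˡ m₂) ⊎ (∃[ b ] x ≡ m₁ ↑ʳ b)
    side x with splitAt m₁ x | Fin.join-splitAt m₁ m₂ x
    ... | inj₁ a | eq = inj₁ (a , sym eq)
    ... | inj₂ b | eq = inj₂ (b , sym eq)

  -- Of any three points, two lie on the same side of the splitting, and the covering of that side
  -- links them.
  union-dominates : ∀ {T₁ T₂} → CoversEdges {K m₁} T₁ → CoversEdges {K m₂} T₂ →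
    ∃[ D ] (Unique D × IsDominating (Johnson (m₁ + m₂) 3) D × length D ≤ length T₁ + length T₂)
  union-dominates {T₁} {T₂} cover₁ cover₂ = deduplicate _≟ᴷ_ D , deduplicate-distinct _≟ᴷ_ D , dominating , size
    where
    left : Triangle (K m₁) → KSubset (m₁ + m₂) 3
    left = embed (_↑ˡ m₂) (Fin.↑ˡ-injective m₂ _ _)
    right : Triangle (K m₂) → KSubset (m₁ + m₂) 3
    right = embed (m₁ ↑ʳ_) (Fin.↑ʳ-injective m₁ _ _)
    D = List.map left T₁ ++ List.map right T₂
    left-linked : ∀ {a b} → a ↑ˡ m₂ ≢ b ↑ˡ m₂ → Linked D (a ↑ˡ m₂) (b ↑ˡ m₂)
    left-linked {a} {b} a≢b with find (cover₁ a b (a≢b ∘ cong (_↑ˡ m₂)))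
    ... | t , t∈ , a∈ , b∈ = left t , ∈-++⁺ˡ (∈-map⁺ left t∈) ,
      embed-∋ (_↑ˡ m₂) (Fin.↑ˡ-injective m₂ _ _) t a∈ ,
      embed-∋ (_↑ˡ m₂) (Fin.↑ˡ-injective m₂ _ _) t b∈
    right-linked : ∀ {a b} → m₁ ↑ʳ a ≢ m₁ ↑ʳ b → Linked D (m₁ ↑ʳ a) (m₁ ↑ʳ b)
    right-linked {a} {b} a≢b with find (cover₂ a b (a≢b ∘ cong (m₁ ↑ʳ_)))
    ... | t , t∈ , a∈ , b∈ = right t , ∈-++⁺ʳ _ (∈-map⁺ right t∈) ,
      embed-∋ (m₁ ↑ʳ_) (Fin.↑ʳ-injective m₁ _ _) t a∈ ,
      embed-∋ (m₁ ↑ʳ_) (Fin.↑ʳ-injective m₁ _ _) t b∈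
    links : LinksTriples D
    links {x} {y} {z} x≢y y≢z x≢z with side x | side y | side z
    ... | inj₁ (_ , refl) | inj₁ (_ , refl) | _               = inj₁ (left-linked x≢y)
    ... | inj₂ (_ , refl) | inj₂ (_ , refl) | _               = inj₁ (right-linked x≢y)
    ... | inj₁ (_ , refl) | inj₂ _          | inj₁ (_ , refl) = inj₂ (inj₂ (left-linked x≢z))
    ... | inj₂ (_ , refl) | inj₁ _          | inj₂ (_ , refl) = inj₂ (inj₂ (right-linked x≢z))
    ... | inj₁ _          | inj₂ (_ , refl) | inj₂ (_ , refl) = inj₂ (inj₁ (right-linked y≢z))
    ... | inj₂ _          | inj₁ (_ , refl) | inj₁ (_ , refl) = inj₂ (inj₁ (left-linked y≢z))
    dominating : IsDominating (Johnson (m₁ + m₂) 3) (deduplicate _≟ᴷ_ D)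
    dominating v = Sum.map (∈-deduplicate⁺ _≟ᴷ_) (λ (q , q∈ , adj) → q , ∈-deduplicate⁺ _≟ᴷ_ q∈ , adj)
                           (links⇒dominating links v)
    size : length (deduplicate _≟ᴷ_ D) ≤ length T₁ + length T₂
    size = ≤-trans (length-deduplicate _≟ᴷ_ D) (≤-reflexive (trans (length-++ (List.map left T₁))
      (cong₂ _+_ (length-map left T₁) (length-map right T₂))))

-- The two bounds meet

6*-cancel : ∀ c l → 6 * c ≤ 6 * l + 5 → c ≤ l
6*-cancel c l le = s≤s⁻¹ (*-cancelˡ-< 6 c (suc l) (≤-trans (s≤s le) (≤-reflexive (lem l))))
  where
  lem : ∀ l → suc (6 * l + 5) ≡ 6 * suc l
  lem = solve-∀

domination-≥ : ∀ {n k c₁ c₂} → 3 ≤ k → n ≡ suc (2 * k) → NearOptimal k c₁ c₂ →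
               {D : List (KSubset n 3)} → IsDominating (Johnson n 3) D → c₁ + c₂ ≤ length D
domination-≥ {k = k} {c₁} {c₂} 3≤k refl opt {D} dom = 6*-cancel (c₁ + c₂) (length D) (bound small)
  where
  open NearOptimal opt
  open LowerBound k D (links⇒no-uncovered (dominating⇒links dom))
  bound : excess ≤ 5 ⊎ (excess ≤ 6 × ¬ 6 ∣ suc k * k) → 6 * (c₁ + c₂) ≤ 6 * length D + 5
  bound (inj₁ ≤5) = ≤-trans (≤-reflexive total) (+-mono-≤ lower-bound ≤5)
  -- Strictness of the lower bound absorbs one unit of the excess 6, and divisibility by 6 the other
  -- five.
  bound (inj₂ (≤6 , 6∤)) = begin
    6 * (c₁ + c₂)                ≡⟨ total ⟩
    suc (2 * k) * k + excess     ≤⟨ +-monoʳ-≤ (suc (2 * k) * k) ≤6 ⟩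
    suc (2 * k) * k + 6          ≡⟨ +-suc (suc (2 * k) * k) 5 ⟩
    suc (suc (2 * k) * k) + 5    ≤⟨ +-monoˡ-≤ 5 (strict-lower-bound 3≤k 6∤) ⟩
    6 * length D + 5             ∎
    where open ≤-Reasoning

odd⇒suc-double : ∀ n → 2 ∤ n → ∃[ k ] n ≡ suc (2 * k)
odd⇒suc-double n 2∤n with n divMod 2
... | result k 0F eq = contradiction (divides k eq) 2∤n
... | result k 1F eq = k , trans eq (cong suc (*-comm k 2))

mainTheorem1 : ∀ (n : ℕ) → 2 ∤ n → 7 ≤ n →
    ∃[ d ] (IsDominationNumber (Johnson n 3) d × IsPhi n d)
mainTheorem1 n 2∤n 7≤n with odd⇒suc-double n 2∤n
... | k , n≡ with near-optimal k (*-cancelˡ-≤ 2 (s≤s⁻¹ (subst (7 ≤_) n≡ 7≤n)))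
...   | c₁ , c₂ , opt = c₁ + c₂ , domination , phi
  where
  open NearOptimal opt
  3≤k : 3 ≤ k
  3≤k = *-cancelˡ-≤ 2 (s≤s⁻¹ (subst (7 ≤_) n≡ 7≤n))
  k+k+1≡n : k + suc k ≡ n
  k+k+1≡n = trans (lem k) (sym n≡)
    where
    lem : ∀ k → k + suc k ≡ suc (2 * k)
    lem = solve-∀

  lower : ∀ {D} → IsDominating (Johnson n 3) D → c₁ + c₂ ≤ length D
  lower = domination-≥ 3≤k n≡ opt

  union : ∀ {m₁ m₂} → m₁ + m₂ ≡ n → ∀ {T₁ T₂} → CoversEdges {K m₁} T₁ → CoversEdges {K m₂} T₂ →
          ∃[ D ] (Unique D × IsDominating (Johnson n 3) D × length D ≤ length T₁ + length T₂)
  union refl = union-dominates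

  union-≥ : ∀ {m₁ m₂} → m₁ + m₂ ≡ n → ∀ {T₁ T₂} → CoversEdges {K m₁} T₁ → CoversEdges {K m₂} T₂ →
            c₁ + c₂ ≤ length T₁ + length T₂
  union-≥ eq cover₁ cover₂ with union eq cover₁ cover₂
  ... | _ , _ , dominating , le = ≤-trans (lower dominating) le

  T₁ = triangle-cover 3≤k cover₁
  T₂ = triangle-cover (m≤n⇒m≤1+n 3≤k) cover₂

  -- Repairing and deduplicating triples gives only upper bounds for the two lengths. If either were
  -- smaller, the union would be a dominating family below the lower bound.
  sizes : length (proj₁ T₁) ≡ c₁ × length (proj₁ T₂) ≡ c₂
  sizes with T₁ | T₂
  ... | _ , _ , covers₁ , ≤c₁ | _ , _ , covers₂ , ≤c₂ = +-mono-≤-cancel ≤c₁ ≤c₂ (union-≥ k+k+1≡n covers₁ covers₂)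

  covering-number₁ : IsTriangleCoveringNumber (K k) c₁
  covering-number₁ with T₁ | T₂ | sizes
  ... | T , distinct , covers₁ , _ | _ , _ , covers₂ , _ | refl , refl =
    (T , distinct , covers₁ , refl) ,
    -- A smaller covering of one side, combined with the fixed covering of the other, would again
    -- violate the lower bound; so minimality of each covering number follows by cancellation.
    λ { _ (_ , _ , covers , refl) → +-cancelʳ-≤ c₂ _ _ (union-≥ k+k+1≡n covers covers₂) }

  covering-number₂ : IsTriangleCoveringNumber (K (suc k)) c₂
  covering-number₂ with T₁ | T₂ | sizes
  ... | _ , _ , covers₁ , _ | T , distinct , covers₂ , _ | refl , refl =
    (T , distinct , covers₂ , refl) ,
    λ { _ (_ , _ , covers , refl) → +-cancelˡ-≤ c₁ _ _ (union-≥ k+k+1≡n covers₁ covers) }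

  domination : IsDominationNumber (Johnson n 3) (c₁ + c₂)
  domination with T₁ | T₂
  ... | _ , _ , covers₁ , ≤c₁ | _ , _ , covers₂ , ≤c₂ with union k+k+1≡n covers₁ covers₂
  ...   | D , unique , dominating , le =
    (D , unique , dominating , ≤-antisym (≤-trans le (+-mono-≤ ≤c₁ ≤c₂)) (lower dominating)) ,
    λ { _ (_ , _ , dominating′ , refl) → lower dominating′ }

  phi : IsPhi n (c₁ + c₂)
  phi = (k , suc k , c₁ , c₂ , k+k+1≡n , 3≤k , m≤n⇒m≤1+n 3≤k , covering-number₁ , covering-number₂ , refl) ,
    λ { _ (_ , _ , _ , _ , eq , _ , _ , ((_ , _ , covers , refl) , _) , ((_ , _ , covers′ , refl) , _) , refl) → union-≥ eq covers covers′ }
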